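{- For positive integers $m,n$ and any integer $p\le \min\{m,n\}$, the number of spanning trees of $K_{m,n}-pK_2$ is $$\tau(K_{m,n}-pK_2)=(mn-m-n+p)(mn-m-n)^{p-1}m^{n-p-1}n^{m-p-1}.$$
   Context: $K_{m,n}-pK_2$ denotes the graph obtained from the complete bipartite graph $K_{m,n}$ by deleting the edges of a matching of size $p$ (a "nearly complete bipartite graph"). $\tau(G)$ is the number of spanning trees of $G$. -}

module Defs where

open import Data.Nat using (ℕ; zero; suc; _<_; _≥_; _*_; _∸_)
open import Data.Integer as ℤ using (ℤ; +_)
open import Data.Fin using (Fin; toℕ)
open import Data.Sum using (_⊎_; inj₁; inj₂)
open import Data.Product using (Σ; _×_; ∃)
open import Data.Bool using (Bool; true)
open import Data.Vec using (Vec; lookup)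
open import Data.List using (List; []; _∷_; length)
open import Data.List.Relation.Unary.Unique.Propositional using (Unique)
open import Data.List.Relation.Unary.Linked using (Linked)
open import Data.List.Membership.Propositional using (_∈_)
open import Data.Empty using (⊥)
open import Relation.Nullary using (¬_)
open import Relation.Binary.PropositionalEquality using (_≡_)
open import Function.Bundles using (_⇔_)

V : ℕ → ℕ → Set
V m n = Fin m ⊎ Fin n

-- A set of edges of K_{m,n}: T i j = true iff the edge {inj₁ i, inj₂ j} is present.
EdgeSet : ℕ → ℕ → Set
EdgeSet m n = Vec (Vec Bool n) m

Adj : ∀ {m n} → EdgeSet m n → V m n → V m n → Set
Adj T (inj₁ i) (inj₂ j) = lookup (lookup T i) j ≡ true
Adj T (inj₂ j) (inj₁ i) = lookup (lookup T i) j ≡ true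
Adj T (inj₁ _) (inj₁ _) = ⊥
Adj T (inj₂ _) (inj₂ _) = ⊥

-- Edges of K_{m,n} - pK_2: all pairs (i,j) except the matching {(i,i) : i < p}.
InKmnMinus : ∀ {m n} → ℕ → Fin m → Fin n → Set
InKmnMinus p i j = ¬ (toℕ i ≡ toℕ j × toℕ i < p)

SubgraphOf : ∀ {m n} → ℕ → EdgeSet m n → Set
SubgraphOf {m} {n} p T = ∀ (i : Fin m) (j : Fin n) → lookup (lookup T i) j ≡ true → InKmnMinus p i j

data Walk {m n} (T : EdgeSet m n) : V m n → V m n → Set where
  nil  : ∀ {u} → Walk T u u
  cons : ∀ {u w v} → Adj T u w → Walk T w v → Walk T u v

Connected : ∀ {m n} → EdgeSet m n → Set
Connected {m} {n} T = ∀ (u v : V m n) → Walk T u v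

lastV : ∀ {A : Set} → A → List A → A
lastV v [] = v
lastV _ (w ∷ ws) = lastV w ws

IsCycle : ∀ {m n} → EdgeSet m n → V m n → List (V m n) → Set
IsCycle T v ws = length ws ≥ 2 × Unique (v ∷ ws) × Linked (Adj T) (v ∷ ws) × Adj T (lastV v ws) v

Acyclic : ∀ {m n} → EdgeSet m n → Set
Acyclic {m} {n} T = ∀ (v : V m n) (ws : List (V m n)) → ¬ IsCycle T v ws

IsSpanningTree : (m n p : ℕ) → EdgeSet m n → Set
IsSpanningTree m n p T = SubgraphOf p T × Connected T × Acyclic T

HasCard : {A : Set} → (A → Set) → ℕ → Set
HasCard {A} P N = Σ (List A) λ L → Unique L × (∀ x → (x ∈ L) ⇔ P x) × length L ≡ N

-- m*n times the paper's formula  (mn-m-n+p)(mn-m-n)^{p-1} m^{n-p-1} n^{m-p-1},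
-- with the p = 0 case read as (X+0)X^{-1} = 1.
formulaTimesMN : ℕ → ℕ → ℕ → ℤ
formulaTimesMN m n zero = (+ m) ℤ.^ n ℤ.* (+ n) ℤ.^ m
formulaTimesMN m n (suc q) =
  (X ℤ.+ + suc q) ℤ.* X ℤ.^ q ℤ.* (+ m) ℤ.^ (n ∸ suc q) ℤ.* (+ n) ℤ.^ (m ∸ suc q)
  where X = + (m * n) ℤ.- + m ℤ.- + n

{-# OPTIONS --safe #-}

-- Contract K_{m,n} along any partition of its vertices, and let a block contain l left and r right
-- vertices.  With a = l n + r m, the contracted graph has τ spanning trees, where
--   n² τ = Σ_B r_B² Π_{C ≠ B} a_C.
-- This is proved by removing one left vertex at a time: summing over the set of blocks that the removed
-- vertex is joined to is a binomial-type expansion, since removing it lowers a_C by r_C, the number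
-- of edges from it to C.  Deleting a matching edge is then handled by τ(G − e) = τ(G) − τ(G / e): replacing
-- the two singleton blocks of e by one block changes Π a and the sum above linearly, which after p
-- steps yields X^p and its derivative, X = mn − m − n.
module Submission where

open import Defs
open import Data.Bool using (Bool; true; false; if_then_else_)
open import Data.Empty using (⊥; ⊥-elim)
open import Data.Fin as Fin using (Fin; toℕ; _↑ˡ_; _↑ʳ_; splitAt; fromℕ<)
import Data.Fin.Properties as Fin
open import Data.Integer using (ℤ; +_; _+_; _-_; _*_; _^_; 0ℤ; 1ℤ)
open import Data.Integer.Properties using (pos-+; pos-*; *-distribˡ-+; *-cancelˡ-≡)
open import Data.Integer.Tactic.RingSolver using (solve-∀)
open import Data.List using (List; []; _∷_; length; map; _++_; _ʳ++_; reverse; filter; allFin; cartesianProduct)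
open import Data.List.Membership.Propositional using (_∈_; _∉_)
import Data.List.Membership.DecPropositional as DecMembership
open import Data.List.Membership.Propositional.Properties
  using (∈-++⁺ˡ; ∈-++⁺ʳ; ∈-++⁻; ∈-∃++; ∈-map⁺; ∈-map⁻; ∈-allFin;
         ∈-filter⁺; ∈-filter⁻; ∈-cartesianProduct⁺; ∈-cartesianProduct⁻)
open import Data.List.Membership.Propositional.Properties.WithK using (unique∧set⇒bag)
open import Data.List.Properties using (length-++; length-map; length-tabulate; map-∘)
open import Data.List.Relation.Binary.BagAndSetEquality using (∼bag⇒↭)
open import Data.List.Relation.Binary.Permutation.Propositional using (_↭_; refl; prep; swap; trans; ↭-sym; ↭⇒↭ₛ)
open import Data.List.Relation.Binary.Permutation.Propositional.Properties using (∈-resp-↭; shift; shifts; ↭-reverse)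
import Data.List.Relation.Binary.Permutation.Setoid.Properties as ↭ₛ
open import Data.List.Relation.Unary.All as All using (All; []; _∷_)
open import Data.List.Relation.Unary.AllPairs using ([]; _∷_)
open import Data.List.Relation.Unary.Any using (here; there)
open import Data.List.Relation.Unary.Linked as Linked using (Linked; [-]; _∷_)
open import Data.List.Relation.Unary.Unique.Propositional using (Unique)
import Data.List.Relation.Unary.Unique.Propositional.Properties as Unique
import Data.Nat as ℕ
open import Data.Nat using (ℕ; zero; suc; _≤_; _≥_; z≤n; s≤s)
import Data.Nat.Properties as ℕ
import Data.Nat.Tactic.RingSolver as ℕSolver
open import Data.Product using (∃; _×_; _,_; proj₁; proj₂)
import Data.Product.Properties as Product
open import Data.Sum using (_⊎_; inj₁; inj₂)
import Data.Sum.Properties as Sum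
open import Data.Vec using (Vec; []; _∷_; lookup; tabulate)
open import Data.Vec.Properties using (∷-injectiveʳ; lookup∘tabulate; tabulate∘lookup; tabulate-cong)
open import Function using (_∘_; id)
open import Function.Bundles using (_⇔_; mk⇔; Equivalence)
open import Relation.Binary using (DecidableEquality)
open import Relation.Binary.Construct.Closure.ReflexiveTransitive as Star using (Star; ε; _◅_; _◅◅_)
import Relation.Binary.PropositionalEquality as ≡
open ≡ using (_≡_; _≢_; refl; sym; cong; cong₂; subst)
open import Relation.Nullary using (¬_; Dec; yes; no; does; ¬?)
open import Relation.Nullary.Decidable using (map′)

-- Sums over blocks

-- Arbitrary partitions are what make both recursions close up: deciding the edges at one vertex
-- contracts some of them, and deleting a matching edge requires the count for the contracted graph
-- as well. The closed form comes from the matrix-tree theorem: the Laplacian of the contracted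
-- graph is diag(a) - l rᵀ - r lᵀ, its adjugate has all entries τ, and n² = (Σ r_B)² arises as rᵀ
-- adj r = n² τ. Squaring r rather than l fits an induction over left vertices, since removing one
-- changes neither n nor any r_B. No division occurs anywhere. Identities are multiplied through by
-- n², and for the unmatched vertices also by m, so they hold over the integers even where X is zero
-- or negative; the only factor cancelled at the end is n, which is positive. Trees are counted by
-- deletion-contraction along a list of edges. The closed form needs that list grouped by left
-- vertex, whereas deletion needs the matching in front, so the count must be shown independent of
-- the order.

private
  swapAddends : ∀ r s t → r + s + t ≡ r + t + s
  swapAddends = solve-∀

module _ {A : Set} where

  total product : (A → ℤ) → List A → ℤ
  total b [] = 0ℤ
  total b (x ∷ L) = b x + total b L
  product a [] = 1ℤ
  product a (x ∷ L) = a x * product a L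

  -- Σ_{x ∈ L} b(x)² Π_{y ∈ L, y ≠ x} a(y)
  quad : (b a : A → ℤ) → List A → ℤ
  quad b a [] = 0ℤ
  quad b a (x ∷ L) = b x * b x * product a L + a x * quad b a L

  -- Expansions of product and quad over all ways to merge a subset S of L into one
  -- distinguished block (β, α): merging x costs a factor u(x) and adds (b x, a x) to that block.
  mergeProduct : (u a : A → ℤ) → List A → ℤ → ℤ
  mergeProduct u a [] α = α
  mergeProduct u a (x ∷ L) α = u x * mergeProduct u a L (α + a x) + a x * mergeProduct u a L α

  mergeQuad : (u b a : A → ℤ) → List A → ℤ → ℤ → ℤ
  mergeQuad u b a [] β α = β * β
  mergeQuad u b a (x ∷ L) β α =
    u x * mergeQuad u b a L (β + b x) (α + a x) +
    (a x * mergeQuad u b a L β α + b x * b x * mergeProduct u a L α)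

  module _ {a a′ : A → ℤ} where

    product-cong : ∀ L → (∀ {x} → x ∈ L → a x ≡ a′ x) → product a L ≡ product a′ L
    product-cong [] _ = refl
    product-cong (x ∷ L) eq = cong₂ _*_ (eq (here refl)) (product-cong L (eq ∘ there))

    quad-cong : ∀ {b b′} L → (∀ {x} → x ∈ L → b x ≡ b′ x) → (∀ {x} → x ∈ L → a x ≡ a′ x) →
      quad b a L ≡ quad b′ a′ L
    quad-cong [] _ _ = refl
    quad-cong (x ∷ L) eqb eqa
      rewrite eqb (here refl) | eqa (here refl)
            | product-cong L (eqa ∘ there) | quad-cong L (eqb ∘ there) (eqa ∘ there) = refl

    mergeProduct-cong : ∀ {u u′} L → (∀ {x} → x ∈ L → u x ≡ u′ x) → (∀ {x} → x ∈ L → a x ≡ a′ x) →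
      ∀ α → mergeProduct u a L α ≡ mergeProduct u′ a′ L α
    mergeProduct-cong [] _ _ α = refl
    mergeProduct-cong {u′ = u′} (x ∷ L) equ eqa α
      rewrite equ (here refl) | eqa (here refl)
            | mergeProduct-cong L (equ ∘ there) (eqa ∘ there) (α + a′ x)
            | mergeProduct-cong L (equ ∘ there) (eqa ∘ there) α = refl

    mergeQuad-cong : ∀ {u u′ b b′} L → (∀ {x} → x ∈ L → u x ≡ u′ x) →
      (∀ {x} → x ∈ L → b x ≡ b′ x) → (∀ {x} → x ∈ L → a x ≡ a′ x) →
      ∀ β α → mergeQuad u b a L β α ≡ mergeQuad u′ b′ a′ L β α
    mergeQuad-cong [] _ _ _ β α = refl
    mergeQuad-cong {b′ = b′} (x ∷ L) equ eqb eqa β α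
      rewrite equ (here refl) | eqb (here refl) | eqa (here refl)
            | mergeQuad-cong L (equ ∘ there) (eqb ∘ there) (eqa ∘ there) (β + b′ x) (α + a′ x)
            | mergeQuad-cong L (equ ∘ there) (eqb ∘ there) (eqa ∘ there) β α
            | mergeProduct-cong L (equ ∘ there) (eqa ∘ there) α = refl

  module _ (b a : A → ℤ) where

    mergeProduct-zero : ∀ L α → mergeProduct (λ _ → 0ℤ) a L α ≡ α * product a L
    mergeProduct-zero [] α = lemma α
      where lemma : ∀ α → α ≡ α * 1ℤ
            lemma = solve-∀
    mergeProduct-zero (x ∷ L) α rewrite mergeProduct-zero L α =
      lemma (mergeProduct (λ _ → 0ℤ) a L (α + a x)) (a x) α (product a L)
      where lemma : ∀ g a α p → 0ℤ * g + a * (α * p) ≡ α * (a * p)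
            lemma = solve-∀

    -- With zero costs only the empty subset survives. This is the situation in which the removed
    -- vertex has no edges left to decide.
    mergeQuad-zero : ∀ L β α → mergeQuad (λ _ → 0ℤ) b a L β α ≡ β * β * product a L + α * quad b a L
    mergeQuad-zero [] β α = lemma β α
      where lemma : ∀ β α → β * β ≡ β * β * 1ℤ + α * 0ℤ
            lemma = solve-∀
    mergeQuad-zero (x ∷ L) β α rewrite mergeQuad-zero L β α | mergeProduct-zero L α =
      lemma (mergeQuad (λ _ → 0ℤ) b a L (β + b x) (α + a x)) (b x) (a x) β α (product a L) (quad b a L)
      where lemma : ∀ g b a β α p q → 0ℤ * g + (a * (β * β * p + α * q) + b * b * (α * p)) ≡
                                      β * β * (a * p) + α * (b * b * p + a * q)
            lemma = solve-∀

    -- Summing over subsets turns each pair of factors `b x`, `a x` into `a x + b x`. The summand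
    -- `a y` of the merged block comes with the factor `b y`, and
    -- `a y * b y = a⁺ y * b y - b y * b y` splits it into the `total` and the `quad` term.
    mergeProduct-full : ∀ L α → let a⁺ = λ x → a x + b x in
      mergeProduct b a L α ≡ (α + total b L) * product a⁺ L - quad b a⁺ L
    mergeProduct-full [] α = lemma α
      where lemma : ∀ α → α ≡ (α + 0ℤ) * 1ℤ - 0ℤ
            lemma = solve-∀
    mergeProduct-full (x ∷ L) α
      rewrite mergeProduct-full L α | mergeProduct-full L (α + a x) =
      lemma (b x) (a x) α (total b L) (product _ L) (quad b _ L)
      where lemma : ∀ b a α s p q →
                    b * ((α + a + s) * p - q) + a * ((α + s) * p - q) ≡
                    (α + (b + s)) * ((a + b) * p) - (b * b * p + (a + b) * q)
            lemma = solve-∀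

    -- The right-hand side is again a `quad`, over `L` with one further block of weights `β` and
    -- `α + β + β + total b L`. So the expansion over one removed vertex reproduces the shape of the
    -- formula.
    mergeQuad-full : ∀ L β α → let a⁺ = λ x → a x + b x in
      mergeQuad b b a L β α ≡ β * β * product a⁺ L + (α + β + β + total b L) * quad b a⁺ L
    mergeQuad-full [] β α = lemma β α
      where lemma : ∀ β α → β * β ≡ β * β * 1ℤ + (α + β + β + 0ℤ) * 0ℤ
            lemma = solve-∀
    mergeQuad-full (x ∷ L) β α
      rewrite mergeQuad-full L (β + b x) (α + a x) | mergeQuad-full L β α | mergeProduct-full L α =
      lemma (b x) (a x) β α (total b L) (product _ L) (quad b _ L)
      where lemma : ∀ b a β α s p q →
                    b * ((β + b) * (β + b) * p + (α + a + (β + b) + (β + b) + s) * q) +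
                    (a * (β * β * p + (α + β + β + s) * q) + b * b * ((α + s) * p - q)) ≡
                    β * β * ((a + b) * p) + (α + β + β + (b + s)) * (b * b * p + (a + b) * q)
            lemma = solve-∀

  module _ {u u′ : A → ℤ} (a : A → ℤ) {y : A} (step : u′ y ≡ 1ℤ + u y) where

    -- The expansions are affine in each single cost, and the coefficient of `u y` is the expansion
    -- in which `y` has already been merged. This is the algebraic counterpart of
    -- deletion-contraction for one more edge to the block `y`.
    mergeProduct-suc : ∀ L₁ L₂ → (∀ {x} → x ∈ L₁ → u′ x ≡ u x) → (∀ {x} → x ∈ L₂ → u′ x ≡ u x) → ∀ α →
      mergeProduct u′ a (L₁ ++ y ∷ L₂) α ≡
      mergeProduct u a (L₁ ++ y ∷ L₂) α + mergeProduct u a (L₁ ++ L₂) (α + a y)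
    mergeProduct-suc [] L₂ _ same α
      rewrite step | mergeProduct-cong {a = a} L₂ same (λ _ → refl) α
            | mergeProduct-cong {a = a} L₂ same (λ _ → refl) (α + a y) =
      lemma (u y) (a y) (mergeProduct u a L₂ (α + a y)) (mergeProduct u a L₂ α)
      where lemma : ∀ u a g h → (1ℤ + u) * g + a * h ≡ u * g + a * h + g
            lemma = solve-∀
    mergeProduct-suc (x ∷ L₁) L₂ same₁ same₂ α
      rewrite same₁ (here refl)
            | mergeProduct-suc L₁ L₂ (same₁ ∘ there) same₂ (α + a x)
            | mergeProduct-suc L₁ L₂ (same₁ ∘ there) same₂ α
            | swapAddends α (a x) (a y) =
      lemma (u x) (a x) (mergeProduct u a (L₁ ++ y ∷ L₂) (α + a x)) (mergeProduct u a (L₁ ++ L₂) (α + a y + a x))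
        (mergeProduct u a (L₁ ++ y ∷ L₂) α) (mergeProduct u a (L₁ ++ L₂) (α + a y))
      where lemma : ∀ u a g g′ h h′ → u * (g + g′) + a * (h + h′) ≡ u * g + a * h + (u * g′ + a * h′)
            lemma = solve-∀

    mergeQuad-suc : ∀ b L₁ L₂ → (∀ {x} → x ∈ L₁ → u′ x ≡ u x) → (∀ {x} → x ∈ L₂ → u′ x ≡ u x) → ∀ β α →
      mergeQuad u′ b a (L₁ ++ y ∷ L₂) β α ≡
      mergeQuad u b a (L₁ ++ y ∷ L₂) β α + mergeQuad u b a (L₁ ++ L₂) (β + b y) (α + a y)
    mergeQuad-suc b [] L₂ _ same β α
      rewrite step | mergeProduct-cong {a = a} L₂ same (λ _ → refl) α
            | mergeQuad-cong {a = a} {b = b} L₂ same (λ _ → refl) (λ _ → refl) β α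
            | mergeQuad-cong {a = a} {b = b} L₂ same (λ _ → refl) (λ _ → refl) (β + b y) (α + a y) =
      lemma (u y) (mergeQuad u b a L₂ (β + b y) (α + a y))
        (a y * mergeQuad u b a L₂ β α + b y * b y * mergeProduct u a L₂ α)
      where lemma : ∀ u g h → (1ℤ + u) * g + h ≡ u * g + h + g
            lemma = solve-∀
    mergeQuad-suc b (x ∷ L₁) L₂ same₁ same₂ β α
      rewrite same₁ (here refl)
            | mergeQuad-suc b L₁ L₂ (same₁ ∘ there) same₂ (β + b x) (α + a x)
            | mergeQuad-suc b L₁ L₂ (same₁ ∘ there) same₂ β α
            | mergeProduct-suc L₁ L₂ (same₁ ∘ there) same₂ α
            | swapAddends α (a x) (a y) | swapAddends β (b x) (b y) =
      lemma (u x) (a x) (b x)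
        (mergeQuad u b a (L₁ ++ y ∷ L₂) (β + b x) (α + a x))
        (mergeQuad u b a (L₁ ++ L₂) (β + b y + b x) (α + a y + a x))
        (mergeQuad u b a (L₁ ++ y ∷ L₂) β α) (mergeQuad u b a (L₁ ++ L₂) (β + b y) (α + a y))
        (mergeProduct u a (L₁ ++ y ∷ L₂) α) (mergeProduct u a (L₁ ++ L₂) (α + a y))
      where lemma : ∀ u a b g g′ h h′ k k′ →
              u * (g + g′) + (a * (h + h′) + b * b * (k + k′)) ≡
              u * g + (a * h + b * b * k) + (u * g′ + (a * h′ + b * b * k′))
            lemma = solve-∀

product-↭ : ∀ {A : Set} (a : A → ℤ) {L M} → L ↭ M → product a L ≡ product a M
product-↭ a refl = refl
product-↭ a (prep x p) = cong (a x *_) (product-↭ a p)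
product-↭ a (swap {ys = M} x y p) rewrite product-↭ a p = lemma (a x) (a y) (product a M)
  where lemma : ∀ r s t → r * (s * t) ≡ s * (r * t)
        lemma = solve-∀
product-↭ a (trans p q) = ≡.trans (product-↭ a p) (product-↭ a q)

quad-↭ : ∀ {A : Set} (b a : A → ℤ) {L M} → L ↭ M → quad b a L ≡ quad b a M
quad-↭ b a refl = refl
quad-↭ b a (prep x p) rewrite product-↭ a p | quad-↭ b a p = refl
quad-↭ b a (swap {ys = M} x y p) rewrite product-↭ a p | quad-↭ b a p =
  lemma (b x) (b y) (a x) (a y) (product a M) (quad b a M)
  where lemma : ∀ b b′ a a′ p q → b * b * (a′ * p) + a * (b′ * b′ * p + a′ * q) ≡
                                  b′ * b′ * (a * p) + a′ * (b * b * p + a * q)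
        lemma = solve-∀
quad-↭ b a (trans p q) = ≡.trans (quad-↭ b a p) (quad-↭ b a q)

module _ {A : Set} (a : A → ℤ) where

  product-++ : ∀ L M → product a (L ++ M) ≡ product a L * product a M
  product-++ [] M = lemma (product a M)
    where lemma : ∀ p → p ≡ 1ℤ * p
          lemma = solve-∀
  product-++ (x ∷ L) M rewrite product-++ L M = lemma (a x) (product a L) (product a M)
    where lemma : ∀ a p q → a * (p * q) ≡ a * p * q
          lemma = solve-∀

  product-const : ∀ {r} L → (∀ {x} → x ∈ L → a x ≡ r) → product a L ≡ r ^ length L
  product-const [] _ = refl
  product-const (x ∷ L) const = cong₂ _*_ (const (here refl)) (product-const L (const ∘ there))

module _ {A : Set} (b a : A → ℤ) where

  quad-++ : ∀ L M → quad b a (L ++ M) ≡ quad b a L * product a M + product a L * quad b a M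
  quad-++ [] M = lemma (product a M) (quad b a M)
    where lemma : ∀ p q → q ≡ 0ℤ * p + 1ℤ * q
          lemma = solve-∀
  quad-++ (x ∷ L) M rewrite quad-++ L M | product-++ a L M =
    lemma (b x) (a x) (product a L) (quad b a L) (product a M) (quad b a M)
    where lemma : ∀ b a p q p′ q′ → b * b * (p * p′) + a * (q * p′ + p * q′) ≡ (b * b * p + a * q) * p′ + a * p * q′
          lemma = solve-∀

  quad-zero : ∀ L → (∀ {x} → x ∈ L → b x ≡ 0ℤ) → quad b a L ≡ 0ℤ
  quad-zero [] _ = refl
  quad-zero (x ∷ L) zeros rewrite zeros (here refl) | quad-zero L (zeros ∘ there) = lemma (product a L) (a x)
    where lemma : ∀ p a → 0ℤ * 0ℤ * p + a * 0ℤ ≡ 0ℤ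
          lemma = solve-∀

  -- The sum itself is k r^(k-1) with k = `length L`; the factor `r` keeps the exponent natural,
  -- also for the empty list.
  quad-const : ∀ {r} L → (∀ {x} → x ∈ L → b x ≡ 1ℤ) → (∀ {x} → x ∈ L → a x ≡ r) →
    r * quad b a L ≡ + length L * r ^ length L
  quad-const {r} [] _ _ = lemma r
    where lemma : ∀ r → r * 0ℤ ≡ 0ℤ * 1ℤ
          lemma = solve-∀
  quad-const {r} (x ∷ L) ones const
    rewrite ones (here refl) | const (here refl) | product-const a L (const ∘ there) = begin
      r * (1ℤ * 1ℤ * r ^ length L + r * quad b a L)
        ≡⟨ cong (λ q → r * (1ℤ * 1ℤ * r ^ length L + q)) (quad-const L (ones ∘ there) (const ∘ there)) ⟩
      r * (1ℤ * 1ℤ * r ^ length L + + length L * r ^ length L)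
        ≡⟨ lemma r (r ^ length L) (+ length L) ⟩
      (1ℤ + + length L) * (r * r ^ length L) ∎
    where
    open ≡.≡-Reasoning
    lemma : ∀ r s k → r * (1ℤ * 1ℤ * s + k * s) ≡ (1ℤ + k) * (r * s)
    lemma = solve-∀

-- The derivative of X ^ k.
power′ : ℤ → ℕ → ℤ
power′ X zero = 0ℤ
power′ X (suc k) = X * power′ X k + X ^ k

power′-suc : ∀ X k → power′ X (suc k) ≡ + suc k * X ^ k
power′-suc X zero = lemma X
  where lemma : ∀ X → X * 0ℤ + 1ℤ ≡ 1ℤ * 1ℤ
        lemma = solve-∀
power′-suc X (suc k) rewrite power′-suc X k = lemma X (+ suc k) (X ^ k)
  where lemma : ∀ X k s → X * (k * s) + X * s ≡ (1ℤ + k) * (X * s)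
        lemma = solve-∀

-- Cycles and paths

module _ {A : Set} where

  -- `IsCycle T` unfolds to this at `Adj T`; the general relation lets cycles be transported between
  -- matrices and edge lists.
  Cycle : (A → A → Set) → A → List A → Set
  Cycle R v ws = length ws ≥ 2 × Unique (v ∷ ws) × Linked R (v ∷ ws) × R (lastV v ws) v

  Cycle-map : ∀ {R S : A → A → Set} → (∀ {x y} → R x y → S x y) → ∀ {v ws} → Cycle R v ws → Cycle S v ws
  Cycle-map f (long , unique , linked , closing) = long , unique , Linked.map f linked , f closing

  lastV-∈ : ∀ z (zs : List A) → lastV z zs ∈ z ∷ zs
  lastV-∈ z [] = here refl
  lastV-∈ z (y ∷ zs) = there (lastV-∈ y zs)

  linked-invariant : ∀ {R : A → A → Set} {c : A → A} → (∀ {x y} → R x y → c x ≡ c y) →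
    ∀ z zs → Linked R (z ∷ zs) → c z ≡ c (lastV z zs)
  linked-invariant inv z [] _ = refl
  linked-invariant inv z (y ∷ zs) (r ∷ rs) = ≡.trans (inv r) (linked-invariant inv y zs rs)

  Ends : A → A → A → A → Set
  Ends u w x y = (x ≡ u × y ≡ w) ⊎ (x ≡ w × y ≡ u)

  Ends-touch : ∀ {u w a b x y} → Ends u w a b → Ends u w x y → a ≡ x ⊎ a ≡ y
  Ends-touch (inj₁ (refl , _)) (inj₁ (refl , _)) = inj₁ refl
  Ends-touch (inj₁ (refl , _)) (inj₂ (_ , refl)) = inj₂ refl
  Ends-touch (inj₂ (refl , _)) (inj₁ (_ , refl)) = inj₂ refl
  Ends-touch (inj₂ (refl , _)) (inj₂ (refl , _)) = inj₁ refl

  module Bridge {R R′ : A → A → Set} {c : A → A} {u w : A}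
    (inv : ∀ {x y} → R x y → c x ≡ c y)
    (new : ∀ {x y} → R′ x y → R x y ⊎ Ends u w x y)
    (cu≢cw : c u ≢ c w) where

    Ends-apart : ∀ {x y} → Ends u w x y → c x ≢ c y
    Ends-apart (inj₁ (refl , refl)) = cu≢cw
    Ends-apart (inj₂ (refl , refl)) = cu≢cw ∘ sym

    -- Every use of the new edge visits both of its ends, in particular `a`.
    avoiding : ∀ {a b} → Ends u w a b → ∀ z zs → All (a ≢_) (z ∷ zs) → Linked R′ (z ∷ zs) → Linked R (z ∷ zs)
    avoiding e z [] _ _ = [-]
    avoiding e z (y ∷ zs) (a≢z ∷ a≢y ∷ a≢zs) (r ∷ rs) with new r
    ... | inj₁ s = s ∷ avoiding e y zs (a≢y ∷ a≢zs) rs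
    ... | inj₂ e′ with Ends-touch e e′
    ...   | inj₁ a≡z = ⊥-elim (a≢z a≡z)
    ...   | inj₂ a≡y = ⊥-elim (a≢y a≡y)

    -- A path through the new edge, traversed from `a` to `b`. As no vertex repeats, the edge is
    -- used only once, so the two ends of the path carry the colours of `a` and `b`. The field
    -- `short` anticipates a closing edge that is the same new edge traversed backwards.
    record Crossing (z : A) (zs : List A) : Set where
      field
        a b : A
        ends : Ends u w a b
        start : c z ≡ c a
        finish : c (lastV z zs) ≡ c b
        visits : a ∈ z ∷ zs
        short : z ≡ a → lastV z zs ≡ b → length zs ≡ 1

    crossing? : ∀ z zs → Unique (z ∷ zs) → Linked R′ (z ∷ zs) → Linked R (z ∷ zs) ⊎ Crossing z zs
    crossing? z [] _ _ = inj₁ [-]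
    crossing? z (y ∷ zs) (z∉ ∷ uniq) (r ∷ rs) with new r
    ... | inj₂ e = inj₂ record
      { a = z ; b = y ; ends = e ; start = refl
      ; finish = sym (linked-invariant {R = R} inv y zs (avoiding e y zs z∉ rs))
      ; visits = here refl ; short = λ _ → short zs uniq }
      where
      short : ∀ zs → Unique (y ∷ zs) → lastV y zs ≡ y → length (y ∷ zs) ≡ 1
      short [] _ _ = refl
      short (t ∷ ts) (y∉ ∷ _) last≡y = ⊥-elim (All.lookup y∉ (lastV-∈ t ts) (sym last≡y))
    ... | inj₁ s with crossing? y zs uniq rs
    ...   | inj₁ linked = inj₁ (s ∷ linked)
    ...   | inj₂ x = inj₂ record
      { a = a ; b = b ; ends = ends ; start = ≡.trans (inv s) start ; finish = finish
      ; visits = there visits ; short = λ z≡a _ → ⊥-elim (All.lookup z∉ visits z≡a) }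
      where open Crossing x

    -- The colour changes only along the new edge, and around a closed walk it must change back. The
    -- path crosses at most once, so a cycle through the new edge would consist of a crossing path
    -- and the same edge as closing edge; then `short` gives length one, against `length ws ≥ 2`.
    Cycle-old : ∀ {v ws} → Cycle R′ v ws → Cycle R v ws
    Cycle-old {v} {ws} (long , uniq , linked , closing) with crossing? v ws uniq linked | new closing
    ... | inj₁ linked′ | inj₁ s = long , uniq , linked′ , s
    ... | inj₁ linked′ | inj₂ e = ⊥-elim (Ends-apart e (sym (linked-invariant {R = R} inv v ws linked′)))
    ... | inj₂ x | inj₁ s = ⊥-elim (Ends-apart ends (≡.trans (sym start) (≡.trans (sym (inv s)) finish)))
      where open Crossing x
    ... | inj₂ x | inj₂ e = ⊥-elim (closed (Crossing.ends x) e)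
      where
      open Crossing x
      tooShort : ∀ {k} → k ≥ 2 → k ≢ 1
      tooShort (s≤s (s≤s _)) ()
      closed : Ends u w a b → Ends u w (lastV v ws) v → ⊥
      closed (inj₁ (a≡u , b≡w)) (inj₁ (_ , v≡w)) = Ends-apart ends (≡.trans (sym start) (cong c (≡.trans v≡w (sym b≡w))))
      closed (inj₁ (a≡u , b≡w)) (inj₂ (l≡w , v≡u)) = tooShort long (short (≡.trans v≡u (sym a≡u)) (≡.trans l≡w (sym b≡w)))
      closed (inj₂ (a≡w , b≡u)) (inj₁ (l≡u , v≡w)) = tooShort long (short (≡.trans v≡w (sym a≡w)) (≡.trans l≡u (sym b≡u)))
      closed (inj₂ (a≡w , b≡u)) (inj₂ (_ , v≡u)) = Ends-apart ends (≡.trans (sym start) (cong c (≡.trans v≡u (sym b≡u))))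

  record SimplePath (R : A → A → Set) (u v : A) : Set where
    constructor path
    field
      inner : List A
      unique : Unique (u ∷ inner)
      linked : Linked R (u ∷ inner)
      ends-at : lastV u inner ≡ v

  suffix : ∀ {R u z v} → (p : SimplePath R z v) → u ∈ z ∷ SimplePath.inner p → SimplePath R u v
  suffix p (here refl) = p
  suffix (path (y ∷ zs) (_ ∷ uniq) (_ ∷ linked) last) (there u∈) = suffix (path zs uniq linked last) u∈

  module _ (_≟_ : DecidableEquality A) {R : A → A → Set} where

    open DecMembership _≟_ using (_∈?_)

    -- Loop erasure: if the new starting vertex already lies on the simplified remainder, only the
    -- part from that occurrence onwards is kept.
    simplify : ∀ {u v} → Star R u v → SimplePath R u v
    simplify ε = path [] ([] ∷ []) [-] refl
    simplify {u} (_◅_ {j = y} r walk) with simplify walk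
    ... | p@(path zs uniq linked last) with u ∈? y ∷ zs
    ...   | yes u∈ = suffix p u∈
    ...   | no u∉ = path (y ∷ zs) (All.tabulate (λ x∈ u≡x → u∉ (subst (_∈ y ∷ zs) (sym u≡x) x∈)) ∷ uniq) (r ∷ linked) last

    -- The hypotheses `u ≢ v` and `¬ R u v` exclude simple paths of zero and one step, which is
    -- exactly what the bound `length ws ≥ 2` demands.
    Cycle-close : ∀ {R′ : A → A → Set} {u v} → Star R u v → u ≢ v → ¬ R u v →
      (∀ {x y} → R x y → R′ x y) → R′ v u → ∃ (Cycle R′ u)
    Cycle-close walk u≢v ¬Ruv old r with simplify walk
    ... | path [] _ _ u≡v = ⊥-elim (u≢v u≡v)
    ... | path (_ ∷ []) _ (s ∷ _) refl = ⊥-elim (¬Ruv s)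
    ... | path ws@(_ ∷ _ ∷ _) uniq linked refl = ws , s≤s (s≤s z≤n) , uniq , Linked.map old linked , r

-- Cardinalities

HasCard-empty : ∀ {A : Set} {P : A → Set} → (∀ x → ¬ P x) → HasCard P 0
HasCard-empty none = [] , [] , (λ x → mk⇔ (λ ()) (⊥-elim ∘ none x)) , refl

HasCard-⇔ : ∀ {A : Set} {P Q : A → Set} {N} → (∀ x → P x ⇔ Q x) → HasCard P N → HasCard Q N
HasCard-⇔ equiv (L , uniq , spec , len) =
  L , uniq , (λ x → mk⇔ (to (equiv x) ∘ to (spec x)) (from (spec x) ∘ from (equiv x))) , len
  where open Equivalence

-- `f ∘ g` need be the identity only on `Q`: a Boolean matrix may have entries that are no edges of
-- the graph, and these are lost on passing to a subset of the edge list.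
HasCard-map : ∀ {A B : Set} {P : A → Set} {Q : B → Set} {N} (f : A → B) (g : B → A) →
  (∀ x → g (f x) ≡ x) → (∀ x → P x → Q (f x)) → (∀ y → Q y → P (g y) × f (g y) ≡ y) →
  HasCard P N → HasCard Q N
HasCard-map {P = P} {Q} f g gf P⇒Q Q⇒P (L , uniq , spec , len) =
  map f L , Unique.map⁺ f-injective uniq , (λ y → mk⇔ (to′ y) (from′ y)) , ≡.trans (length-map f L) len
  where
  open Equivalence
  f-injective : ∀ {x y} → f x ≡ f y → x ≡ y
  f-injective {x} {y} eq = ≡.trans (sym (gf x)) (≡.trans (cong g eq) (gf y))
  to′ : ∀ y → y ∈ map f L → Q y
  to′ y y∈ with ∈-map⁻ f y∈
  ... | x , x∈ , refl = P⇒Q x (to (spec x) x∈)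
  from′ : ∀ y → Q y → y ∈ map f L
  from′ y qy with Q⇒P y qy
  ... | p , fg = subst (_∈ map f L) fg (∈-map⁺ f (from (spec (g y)) p))

HasCard-∷ : ∀ {k M N} {P : Vec Bool (suc k) → Set} →
  HasCard (P ∘ (false ∷_)) M → HasCard (P ∘ (true ∷_)) N → HasCard P (M ℕ.+ N)
HasCard-∷ {P = P} (L₀ , uniq₀ , spec₀ , len₀) (L₁ , uniq₁ , spec₁ , len₁) =
  map (false ∷_) L₀ ++ map (true ∷_) L₁ ,
  Unique.++⁺ (Unique.map⁺ ∷-injectiveʳ uniq₀) (Unique.map⁺ ∷-injectiveʳ uniq₁) disjoint ,
  (λ x → mk⇔ (to′ x) (from′ x)) ,
  ≡.trans (length-++ (map (false ∷_) L₀)) (cong₂ ℕ._+_ (≡.trans (length-map _ L₀) len₀) (≡.trans (length-map _ L₁) len₁))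
  where
  open Equivalence
  disjoint : ∀ {v} → v ∈ map (false ∷_) L₀ × v ∈ map (true ∷_) L₁ → ⊥
  disjoint (p , q) with ∈-map⁻ _ p | ∈-map⁻ _ q
  ... | _ , _ , refl | _ , _ , ()
  to′ : ∀ x → x ∈ map (false ∷_) L₀ ++ map (true ∷_) L₁ → P x
  to′ x x∈ with ∈-++⁻ (map (false ∷_) L₀) x∈
  ... | inj₁ p with ∈-map⁻ _ p
  ...   | bs , bs∈ , refl = to (spec₀ bs) bs∈
  to′ x x∈ | inj₂ p with ∈-map⁻ _ p
  ...   | bs , bs∈ , refl = to (spec₁ bs) bs∈
  from′ : ∀ x → P x → x ∈ map (false ∷_) L₀ ++ map (true ∷_) L₁
  from′ (false ∷ bs) p = ∈-++⁺ˡ (∈-map⁺ _ (from (spec₀ bs) p))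
  from′ (true ∷ bs) p = ∈-++⁺ʳ _ (∈-map⁺ _ (from (spec₁ bs) p))

-- Contraction and tree counting

select : ∀ {A : Set} (es : List A) → Vec Bool (length es) → List A
select [] [] = []
select (e ∷ es) (true ∷ bs) = e ∷ select es bs
select (e ∷ es) (false ∷ bs) = select es bs

module Contraction {A : Set} (_≟_ : DecidableEquality A) where

  relabel : A → A → A → A
  relabel a b z = if does (z ≟ b) then a else z

  relabel-hit : ∀ a b → relabel a b b ≡ a
  relabel-hit a b with b ≟ b
  ... | yes _ = refl
  ... | no b≢b = ⊥-elim (b≢b refl)

  relabel-miss : ∀ a {b z} → z ≢ b → relabel a b z ≡ z
  relabel-miss a {b} {z} z≢b with z ≟ b
  ... | yes z≡b = ⊥-elim (z≢b z≡b)
  ... | no _ = refl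

  -- The universal property of identifying `b` with `a`.
  relabel-absorb : ∀ {B : Set} (h : A → B) {a b} → h a ≡ h b → ∀ z → h (relabel a b z) ≡ h z
  relabel-absorb h {a} {b} eq z with z ≟ b
  ... | yes refl = eq
  ... | no _ = refl

  relabel-self : ∀ a b → relabel a b a ≡ a
  relabel-self a b with a ≟ b
  ... | yes _ = refl
  ... | no _ = refl

  relabel-joins : ∀ a b → relabel a b a ≡ relabel a b b
  relabel-joins a b = ≡.trans (relabel-self a b) (sym (relabel-hit a b))

  -- A labelling c : A → A stands for the quotient of the vertex set by the kernel of c.
  contract : (A → A) → A × A → A → A
  contract c (u , v) z = relabel (c u) (c v) (c z)

  -- A greedy test in the manner of Kruskal: each edge must join two distinct blocks when its turn
  -- comes, and a single block must remain. It matches the recursion of `treeCount`; the link to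
  -- cycles and walks is made by `IsTree-sound` and `IsTree-complete`.
  IsTree : List (A × A) → (A → A) → Set
  IsTree [] c = ∀ x y → c x ≡ c y
  IsTree ((u , v) ∷ es) c = c u ≢ c v × IsTree es (contract c (u , v))

  Joined : List (A × A) → A → A → Set
  Joined es x y = (x , y) ∈ es ⊎ (y , x) ∈ es

  Joined-there : ∀ {e es x y} → Joined es x y → Joined (e ∷ es) x y
  Joined-there (inj₁ p) = inj₁ (there p)
  Joined-there (inj₂ p) = inj₂ (there p)

  Joined-new : ∀ {u v es x y} → Joined ((u , v) ∷ es) x y → Joined es x y ⊎ Ends u v x y
  Joined-new (inj₁ (here refl)) = inj₂ (inj₁ (refl , refl))
  Joined-new (inj₁ (there p)) = inj₁ (inj₁ p)
  Joined-new (inj₂ (here refl)) = inj₂ (inj₂ (refl , refl))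
  Joined-new (inj₂ (there p)) = inj₁ (inj₂ p)

  Joined-ʳ++ : ∀ ds {es x y} → Joined es x y → Joined (ds ʳ++ es) x y
  Joined-ʳ++ [] j = j
  Joined-ʳ++ (d ∷ ds) j = Joined-ʳ++ ds (Joined-there j)

  Acyclic′ Connected′ : List (A × A) → Set
  Acyclic′ es = ∀ v ws → ¬ Cycle (Joined es) v ws
  Connected′ es = ∀ x y → Star (Joined es) x y

  record Components (c : A → A) (es : List (A × A)) : Set where
    field
      sound : ∀ {x y} → c x ≡ c y → Star (Joined es) x y
      complete : ∀ {x y} → Joined es x y → c x ≡ c y

  open Components

  Components-contract : ∀ {c es e} → Components c es → Components (contract c e) (e ∷ es)
  Components-contract {c} {es} {u , v} comp .sound {x} {y} eq with c x ≟ c v | c y ≟ c v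
  ... | yes p | yes q = Star.map Joined-there (sound comp (≡.trans p (sym q)))
  ... | yes p | no q = Star.map Joined-there (sound comp p) ◅◅ (inj₂ (here refl) ◅ Star.map Joined-there (sound comp eq))
  ... | no p | yes q = Star.map Joined-there (sound comp eq) ◅◅ (inj₁ (here refl) ◅ Star.map Joined-there (sound comp (sym q)))
  ... | no p | no q = Star.map Joined-there (sound comp eq)
  Components-contract {c} {es} {u , v} comp .complete j with Joined-new j
  ... | inj₁ j′ = cong (relabel (c u) (c v)) (complete comp j′)
  ... | inj₂ (inj₁ (refl , refl)) = relabel-joins (c u) (c v)
  ... | inj₂ (inj₂ (refl , refl)) = sym (relabel-joins (c u) (c v))

  -- `es` holds the edges already contracted and `ds` those to come. Moving one from `ds` to `es`
  -- leaves `ds ʳ++ es` unchanged by computation. Each accepted edge links two components, so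
  -- `Bridge` excludes a new cycle.
  IsTree-sound : ∀ ds {c es} → Components c es → Acyclic′ es → IsTree ds c →
    Acyclic′ (ds ʳ++ es) × Connected′ (ds ʳ++ es)
  IsTree-sound [] comp acyclic tree = acyclic , λ x y → sound comp (tree x y)
  IsTree-sound (d ∷ ds) {es = es} comp acyclic (cu≢cv , tree) =
    IsTree-sound ds (Components-contract comp)
      (λ v ws → acyclic v ws ∘ Bridge.Cycle-old {R = Joined es} (complete comp) Joined-new cu≢cv) tree

  -- An edge rejected by the test would have its ends already connected by `es`, and it would close
  -- a cycle. For this it must be neither a loop nor parallel to an edge of `es`: orientation from
  -- `Left` to its complement excludes loops and reversed copies, uniqueness excludes repetitions.
  IsTree-complete : (Left : A → Set) → ∀ ds {c es} → Components c es →
    (∀ {x y} → (x , y) ∈ ds ʳ++ es → Left x × ¬ Left y) → Unique (ds ʳ++ es) →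
    Acyclic′ (ds ʳ++ es) → Connected′ (ds ʳ++ es) → IsTree ds c
  IsTree-complete Left [] {c} comp _ _ _ conn x y =
    Star.fold (λ x y → c x ≡ c y) (≡.trans ∘ complete comp) refl (conn x y)
  IsTree-complete Left (d@(u , v) ∷ ds) {c} {es} comp oriented uniq acyclic conn =
    notLoop , IsTree-complete Left ds (Components-contract comp) oriented uniq acyclic conn
    where
    member : ∀ {e} ds {es : List (A × A)} → e ∈ es → e ∈ ds ʳ++ es
    member [] p = p
    member (_ ∷ ds) p = member ds (there p)
    Unique-ʳ++ : ∀ (ds : List (A × A)) {es} → Unique (ds ʳ++ es) → Unique es
    Unique-ʳ++ [] uniq = uniq
    Unique-ʳ++ (d ∷ ds) uniq with Unique-ʳ++ ds uniq
    ... | _ ∷ uniq′ = uniq′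
    d-oriented : Left u × ¬ Left v
    d-oriented = oriented (member ds (here refl))
    u≢v : u ≢ v
    u≢v refl = proj₂ d-oriented (proj₁ d-oriented)
    fresh : ¬ Joined es u v
    fresh (inj₁ p) = Unique.Unique[x∷xs]⇒x∉xs (Unique-ʳ++ ds uniq) p
    fresh (inj₂ p) = proj₂ d-oriented (proj₁ (oriented (member ds (there p))))
    notLoop : c u ≢ c v
    notLoop cu≡cv with Cycle-close _≟_ {R′ = Joined (d ∷ es)} (sound comp cu≡cv) u≢v fresh Joined-there (inj₂ (here refl))
    ... | ws , cycle = acyclic u ws (Cycle-map (Joined-ʳ++ ds) cycle)

  Components-id : Components id []
  Components-id .sound refl = ε
  Components-id .complete (inj₁ ())
  Components-id .complete (inj₂ ())

  Acyclic-[] : Acyclic′ []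
  Acyclic-[] v _ (_ , _ , _ , inj₁ ())
  Acyclic-[] v _ (_ , _ , _ , inj₂ ())

  module Counting (constant? : (c : A → A) → Dec (∀ x y → c x ≡ c y)) where

    treeCount : List (A × A) → (A → A) → ℕ
    treeCount [] c = if does (constant? c) then 1 else 0
    treeCount ((u , v) ∷ es) c =
      treeCount es c ℕ.+ (if does (c u ≟ c v) then 0 else treeCount es (contract c (u , v)))

    treeCount-card : ∀ es c → HasCard (λ bs → IsTree (select es bs) c) (treeCount es c)
    treeCount-card [] c with constant? c
    ... | yes const = ([] ∷ []) , ([] ∷ []) , (λ { [] → mk⇔ (λ _ → const) (λ _ → here refl) }) , refl
    ... | no ¬const = HasCard-empty (λ { [] → ¬const })
    treeCount-card ((u , v) ∷ es) c = HasCard-∷ (treeCount-card es c) taken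
      where
      taken : HasCard (λ bs → c u ≢ c v × IsTree (select es bs) (contract c (u , v)))
        (if does (c u ≟ c v) then 0 else treeCount es (contract c (u , v)))
      taken with c u ≟ c v
      ... | yes loop = HasCard-empty (λ _ (¬loop , _) → ¬loop loop)
      ... | no ¬loop = HasCard-⇔ (λ _ → mk⇔ (¬loop ,_) proj₂) (treeCount-card es (contract c (u , v)))

    treeCount-loop : ∀ {u v} es c → c u ≡ c v → treeCount ((u , v) ∷ es) c ≡ treeCount es c
    treeCount-loop {u} {v} es c loop with c u ≟ c v
    ... | yes _ = ℕ.+-identityʳ _
    ... | no ¬loop = ⊥-elim (¬loop loop)

    treeCount-link : ∀ {u v} es c → c u ≢ c v →
      treeCount ((u , v) ∷ es) c ≡ treeCount es c ℕ.+ treeCount es (contract c (u , v))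
    treeCount-link {u} {v} es c ¬loop with c u ≟ c v
    ... | yes loop = ⊥-elim (¬loop loop)
    ... | no _ = refl

    infix 4 _≲_
    -- Inclusion of kernels. Contracting in a different order may choose other labels, so counts can
    -- only be compared up to equality of kernels.
    _≲_ : (A → A) → (A → A) → Set
    c ≲ d = ∀ x y → c x ≡ c y → d x ≡ d y

    contract-mono : ∀ {c d} e → c ≲ d → contract c e ≲ contract d e
    contract-mono {c} {d} (u , v) c≲d x y eq with c x ≟ c v | c y ≟ c v
    ... | yes p | yes q = cong (relabel (d u) (d v)) (c≲d x y (≡.trans p (sym q)))
    ... | no p | no q = cong (relabel (d u) (d v)) (c≲d x y eq)
    ... | yes p | no q rewrite c≲d x v p | sym (c≲d u y eq) = sym (relabel-joins (d u) (d v))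
    ... | no p | yes q rewrite c≲d y v q | c≲d x u eq = relabel-joins (d u) (d v)

    treeCount-cong : ∀ es {c d} → c ≲ d → d ≲ c → treeCount es c ≡ treeCount es d
    treeCount-cong [] {c} {d} c≲d d≲c with constant? c | constant? d
    ... | yes _ | yes _ = refl
    ... | no _ | no _ = refl
    ... | yes p | no q = ⊥-elim (q λ x y → c≲d x y (p x y))
    ... | no p | yes q = ⊥-elim (p λ x y → d≲c x y (q x y))
    treeCount-cong ((u , v) ∷ es) {c} {d} c≲d d≲c = cong₂ ℕ._+_ (treeCount-cong es c≲d d≲c) taken
      where
      taken : (if does (c u ≟ c v) then 0 else treeCount es (contract c (u , v))) ≡
              (if does (d u ≟ d v) then 0 else treeCount es (contract d (u , v)))
      taken with c u ≟ c v | d u ≟ d v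
      ... | yes _ | yes _ = refl
      ... | no _ | no _ = treeCount-cong es (contract-mono (u , v) c≲d) (contract-mono (u , v) d≲c)
      ... | yes p | no q = ⊥-elim (q (c≲d u v p))
      ... | no p | yes q = ⊥-elim (p (d≲c u v q))

    -- A map h that identifies the ends of both edges factors through either double contraction.
    contract-comm : ∀ c e f → contract (contract c e) f ≲ contract (contract c f) e
    contract-comm c e@(u , v) f@(x , y) z w eq = begin
      h (c z)                                        ≡⟨ factor z ⟨
      h (contract (contract c e) f z)                ≡⟨ cong h eq ⟩
      h (contract (contract c e) f w)                ≡⟨ factor w ⟩
      h (c w)                                        ∎
      where
      open ≡.≡-Reasoning
      ρ = relabel (c x) (c y)
      h : A → A
      h t = relabel (contract c f u) (contract c f v) (ρ t)
      he : h (c u) ≡ h (c v)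
      he = relabel-joins (contract c f u) (contract c f v)
      hf : h (c x) ≡ h (c y)
      hf = cong (relabel (contract c f u) (contract c f v)) (relabel-joins (c x) (c y))
      absorb-e : ∀ t → h (relabel (c u) (c v) t) ≡ h t
      absorb-e = relabel-absorb h he
      factor : ∀ t → h (contract (contract c e) f t) ≡ h (c t)
      factor t = ≡.trans
        (relabel-absorb h (≡.trans (absorb-e (c x)) (≡.trans hf (sym (absorb-e (c y))))) (contract c e t))
        (absorb-e (c t))

    -- Identifying `p` with `q` can merge distinct labels only if these are `p` and `q` themselves.
    -- Hence of two parallel edges either one becomes a loop when the other is contracted.
    relabel-glues : ∀ {a b p q} → a ≢ b → relabel p q a ≡ relabel p q b → relabel a b p ≡ relabel a b q
    relabel-glues {a} {b} {p} {q} a≢b eq with a ≟ q | b ≟ q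
    ... | yes a≡q | yes b≡q = ⊥-elim (a≢b (≡.trans a≡q (sym b≡q)))
    ... | yes refl | no _ rewrite eq = sym (relabel-joins a b)
    ... | no _ | yes refl rewrite sym eq = relabel-joins a b
    ... | no _ | no _ = ⊥-elim (a≢b eq)

    -- The trees through both edges, a loop at either stage giving none.
    second : List (A × A) → (A → A) → A × A → A × A → ℕ
    second es c (u , v) (x , y) =
      if does (c u ≟ c v) then 0 else
      if does (contract c (u , v) x ≟ contract c (u , v) y) then 0 else
      treeCount es (contract (contract c (u , v)) (x , y))

    second-comm : ∀ es c e f → second es c e f ≡ second es c f e
    second-comm es c e@(u , v) f@(x , y) with c u ≟ c v | c x ≟ c y
    ... | yes _ | yes _ = refl
    ... | yes p | no _ with contract c f u ≟ contract c f v
    ...   | yes _ = refl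
    ...   | no r = ⊥-elim (r (cong (relabel (c x) (c y)) p))
    second-comm es c e@(u , v) f@(x , y) | no _ | yes q with contract c e x ≟ contract c e y
    ...   | yes _ = refl
    ...   | no r = ⊥-elim (r (cong (relabel (c u) (c v)) q))
    second-comm es c e@(u , v) f@(x , y) | no p | no q
      with contract c e x ≟ contract c e y | contract c f u ≟ contract c f v
    ... | yes _ | yes _ = refl
    ... | yes r | no s = ⊥-elim (s (relabel-glues q r))
    ... | no r | yes s = ⊥-elim (r (relabel-glues p s))
    ... | no _ | no _ = treeCount-cong es (contract-comm c e f) (contract-comm c f e)

    first : List (A × A) → (A → A) → A × A → ℕ
    first es c (u , v) = if does (c u ≟ c v) then 0 else treeCount es (contract c (u , v))

    -- The four summands are the trees through neither edge, only `f`, only `e`, and both.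
    -- Exchanging the edges permutes the first three among themselves, so the last is the only one
    -- that needs an argument, `second-comm`.
    treeCount-two : ∀ e f es c →
      treeCount (e ∷ f ∷ es) c ≡ treeCount es c ℕ.+ first es c f ℕ.+ (first es c e ℕ.+ second es c e f)
    treeCount-two e@(u , v) f es c = cong (treeCount (f ∷ es) c ℕ.+_) lemma
      where
      lemma : (if does (c u ≟ c v) then 0 else treeCount (f ∷ es) (contract c e)) ≡
              first es c e ℕ.+ second es c e f
      lemma with c u ≟ c v
      ... | yes _ = refl
      ... | no _ = refl

    treeCount-swap : ∀ e f es c → treeCount (e ∷ f ∷ es) c ≡ treeCount (f ∷ e ∷ es) c
    treeCount-swap e f es c
      rewrite treeCount-two e f es c | treeCount-two f e es c | second-comm es c e f =
      lemma (treeCount es c) (first es c f) (first es c e) (second es c f e)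
      where
      lemma : ∀ t r s z → t ℕ.+ r ℕ.+ (s ℕ.+ z) ≡ t ℕ.+ s ℕ.+ (r ℕ.+ z)
      lemma = ℕSolver.solve-∀

    treeCount-∷ : ∀ e es fs → (∀ c → treeCount es c ≡ treeCount fs c) → ∀ c → treeCount (e ∷ es) c ≡ treeCount (e ∷ fs) c
    treeCount-∷ e _ _ eq c rewrite eq c | eq (contract c e) = refl

    treeCount-↭ : ∀ {es fs} → es ↭ fs → ∀ c → treeCount es c ≡ treeCount fs c
    treeCount-↭ refl c = refl
    treeCount-↭ (prep {es} {fs} e p) c = treeCount-∷ e es fs (treeCount-↭ p) c
    treeCount-↭ (swap {es} {fs} e f p) c =
      ≡.trans (treeCount-∷ e (f ∷ es) (f ∷ fs) (treeCount-∷ f es fs (treeCount-↭ p)) c) (treeCount-swap e f fs c)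
    treeCount-↭ (trans p q) c = ≡.trans (treeCount-↭ p c) (treeCount-↭ q c)

-- Complete bipartite graphs

Unique-resp-↭ : ∀ {A : Set} {L M : List A} → L ↭ M → Unique L → Unique M
Unique-resp-↭ {A} p = ↭ₛ.Unique-resp-↭ (≡.setoid A) (↭⇒↭ₛ p)

endpoints : ∀ {A : Set} → List (A × A) → List A
endpoints [] = []
endpoints ((x , y) ∷ ms) = x ∷ y ∷ endpoints ms

endpoints-∈ : ∀ {A : Set} {x y : A} {ms} → (x , y) ∈ ms → x ∈ endpoints ms × y ∈ endpoints ms
endpoints-∈ (here refl) = here refl , there (here refl)
endpoints-∈ (there e∈) with endpoints-∈ e∈
... | x∈ , y∈ = there (there x∈) , there (there y∈)

-- Partitions into labelled blocks and the closed form for contracted graphs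

module ClosedForm {A : Set} (_≟_ : DecidableEquality A) (constant? : (c : A → A) → Dec (∀ x y → c x ≡ c y)) where

  open Contraction _≟_
  open Counting constant?

  indicator : A → A → ℤ
  indicator x y = if does (x ≟ y) then 1ℤ else 0ℤ

  -- Over the left vertices this is l, over the right vertices r, and over the undecided neighbours
  -- of a vertex the number of parallel edges from it to the block `x`.
  fibre : (A → A) → List A → A → ℤ
  fibre c vs x = total (λ v → indicator (c v) x) vs

  fibre-here : ∀ {c v x} vs → c v ≡ x → fibre c (v ∷ vs) x ≡ 1ℤ + fibre c vs x
  fibre-here {c} {v} {x} vs eq with c v ≟ x
  ... | yes _ = refl
  ... | no ¬eq = ⊥-elim (¬eq eq)

  fibre-there : ∀ {c v x} vs → c v ≢ x → fibre c (v ∷ vs) x ≡ fibre c vs x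
  fibre-there {c} {v} {x} vs ¬eq with c v ≟ x
  ... | yes eq = ⊥-elim (¬eq eq)
  ... | no _ = lemma (fibre c vs x)
    where lemma : ∀ z → 0ℤ + z ≡ z
          lemma = solve-∀

  fibre-absent : ∀ {c x} vs → (∀ {v} → v ∈ vs → c v ≢ x) → fibre c vs x ≡ 0ℤ
  fibre-absent [] _ = refl
  fibre-absent (v ∷ vs) absent = ≡.trans (fibre-there vs (absent (here refl))) (fibre-absent vs (absent ∘ there))

  fibre-id : ∀ {x vs} → Unique vs → x ∈ vs → fibre id vs x ≡ 1ℤ
  fibre-id {x} {v ∷ vs} (v∉ ∷ _) (here refl) =
    ≡.trans (fibre-here vs refl) (cong (λ z → 1ℤ + z) (fibre-absent vs (λ w∈ w≡x → All.lookup v∉ w∈ (sym w≡x))))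
  fibre-id {x} {v ∷ vs} (v∉ ∷ uniq) (there x∈) =
    ≡.trans (fibre-there vs (λ v≡x → All.lookup v∉ x∈ v≡x)) (fibre-id uniq x∈)

  fibre-target : ∀ c {p q} → p ≢ q → ∀ vs → fibre (relabel p q ∘ c) vs p ≡ fibre c vs p + fibre c vs q
  fibre-target c p≢q [] = refl
  fibre-target c {p} {q} p≢q (v ∷ vs) = ≡.trans (cong₂ _+_ (lemma (c v)) (fibre-target c p≢q vs))
    (interchange (indicator (c v) p) (indicator (c v) q) (fibre c vs p) (fibre c vs q))
    where
    lemma : ∀ z → indicator (relabel p q z) p ≡ indicator z p + indicator z q
    lemma z with z ≟ q
    lemma z | yes refl with p ≟ p | z ≟ p
    ... | yes _ | no _ = refl
    ... | no p≢p | _ = ⊥-elim (p≢p refl)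
    ... | _ | yes z≡p = ⊥-elim (p≢q (sym z≡p))
    lemma z | no _ with z ≟ p
    ... | yes _ = refl
    ... | no _ = refl
    interchange : ∀ r s t w → r + s + (t + w) ≡ r + t + (s + w)
    interchange = solve-∀

  fibre-other : ∀ c {p q x} → x ≢ p → x ≢ q → ∀ vs → fibre (relabel p q ∘ c) vs x ≡ fibre c vs x
  fibre-other c x≢p x≢q [] = refl
  fibre-other c {p} {q} {x} x≢p x≢q (v ∷ vs) = cong₂ _+_ (lemma (c v)) (fibre-other c x≢p x≢q vs)
    where
    lemma : ∀ z → indicator (relabel p q z) x ≡ indicator z x
    lemma z with z ≟ q
    lemma z | yes refl with p ≟ x | z ≟ x
    ... | no _ | no _ = refl
    ... | yes p≡x | _ = ⊥-elim (x≢p (sym p≡x))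
    ... | no _ | yes z≡x = ⊥-elim (x≢q (sym z≡x))
    lemma z | no _ = refl

  total-indicator : ∀ z L → Unique L → z ∈ L → total (indicator z) L ≡ 1ℤ
  total-indicator z (x ∷ L) (x∉ ∷ uniq) z∈ with z ≟ x
  ... | yes refl = cong (λ z → 1ℤ + z) (absent L x∉)
    where
    absent : ∀ L → All (z ≢_) L → total (indicator z) L ≡ 0ℤ
    absent [] _ = refl
    absent (y ∷ L) (z≢y ∷ z∉) with z ≟ y
    ... | yes z≡y = ⊥-elim (z≢y z≡y)
    ... | no _ = cong (λ z → 0ℤ + z) (absent L z∉)
  total-indicator z (x ∷ L) (x∉ ∷ uniq) (here z≡x) | no z≢x = ⊥-elim (z≢x z≡x)
  total-indicator z (x ∷ L) (x∉ ∷ uniq) (there z∈) | no _ = cong (λ z → 0ℤ + z) (total-indicator z L uniq z∈)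

  total-fibre : ∀ c vs L → Unique L → (∀ v → c v ∈ L) → total (fibre c vs) L ≡ + length vs
  total-fibre c [] L _ _ = zeros L
    where
    zeros : ∀ L → total (λ _ → 0ℤ) L ≡ 0ℤ
    zeros [] = refl
    zeros (x ∷ L) = cong (λ z → 0ℤ + z) (zeros L)
  total-fibre c (v ∷ vs) L uniq covers = ≡.trans (split L)
    (cong₂ _+_ (total-indicator (c v) L uniq (covers v)) (total-fibre c vs L uniq covers))
    where
    interchange : ∀ r s t w → r + s + (t + w) ≡ r + t + (s + w)
    interchange = solve-∀
    split : ∀ L → total (fibre c (v ∷ vs)) L ≡ total (indicator (c v)) L + total (fibre c vs) L
    split [] = refl
    split (x ∷ L) = ≡.trans (cong (λ z → fibre c (v ∷ vs) x + z) (split L))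
      (interchange (indicator (c v) x) (fibre c vs x) (total (indicator (c v)) L) (total (fibre c vs) L))

  -- `L` names every block once. By `fixed` the name of a block is a vertex inside it, so no listed
  -- block is empty and distinct names are distinct values of `c`.
  record Live (c : A → A) (L : List A) : Set where
    field
      unique : Unique L
      covers : ∀ v → c v ∈ L
      fixed : ∀ {x} → x ∈ L → c x ≡ x

  open Live

  Live-↭ : ∀ {c L M} → L ↭ M → Live c L → Live c M
  Live-↭ p live .unique = Unique-resp-↭ p (unique live)
  Live-↭ p live .covers v = ∈-resp-↭ p (covers live v)
  Live-↭ p live .fixed = fixed live ∘ ∈-resp-↭ (↭-sym p)

  head-≢ : ∀ {x y : A} {L} → Unique (x ∷ L) → y ∈ L → y ≢ x
  head-≢ uniq y∈ refl = Unique.Unique[x∷xs]⇒x∉xs uniq y∈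

  Live-relabel : ∀ {c p q L} → Live c (p ∷ q ∷ L) → Live (relabel p q ∘ c) (p ∷ L)
  Live-relabel {c} {p} {q} {L} live with unique live
  ... | (p≢q ∷ p∉) ∷ (q∉ ∷ uniq) = record { unique = p∉ ∷ uniq ; covers = covers′ ; fixed = fixed′ }
    where
    covers′ : ∀ v → relabel p q (c v) ∈ p ∷ L
    covers′ v with c v ≟ q | covers live v
    ... | yes _ | _ = here refl
    ... | no _ | here cv≡p = here cv≡p
    ... | no cv≢q | there (here cv≡q) = ⊥-elim (cv≢q cv≡q)
    ... | no _ | there (there cv∈) = there cv∈
    fixed′ : ∀ {x} → x ∈ p ∷ L → relabel p q (c x) ≡ x
    fixed′ (here refl) rewrite fixed live (here refl) = relabel-self p q
    fixed′ (there x∈) rewrite fixed live (there (there x∈)) = relabel-miss p (All.lookup q∉ x∈ ∘ sym)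

  module Bipartite (R : List A) where

    n : ℤ
    n = + length R

    b : (A → A) → A → ℤ
    b c = fibre c R

    a : (A → A) → List A → A → ℤ
    a c I x = fibre c I x * n + b c x * + length I

    -- Removing a left vertex from `I` removes only its edges. The vertex stays in its block and
    -- contributes nothing to `a` or `b`; a block made up of such vertices has both weights zero, so
    -- `quad` vanishes as soon as there is a second block, as it must for a disconnected graph.
    ClosedForm : List A → Set
    ClosedForm I = ∀ c L → Live c L → n * n * + treeCount (cartesianProduct I R) c ≡ quad (b c) (a c I) L

    -- Without edges every `a` is zero, so `quad` survives only for a single block, where r = n and
    -- the value is n². If there are no blocks at all, `total-fibre` forces n = 0.
    closedForm-[] : ClosedForm []
    closedForm-[] c [] live = cong (λ k → k * k * + treeCount [] c) (sym (total-fibre c R [] [] (covers live)))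
    closedForm-[] c (x ∷ []) live with constant? c
    ... | no ¬const = ⊥-elim (¬const λ y z → ≡.trans (only y) (sym (only z)))
      where
      only : ∀ y → c y ≡ x
      only y with covers live y
      ... | here eq = eq
    ... | yes _ = ≡.trans (cong (λ k → k * k * 1ℤ) (sym size)) (lemma (b c x) (a c [] x))
      where
      identityʳ : ∀ k → k + 0ℤ ≡ k
      identityʳ = solve-∀
      size : b c x ≡ n
      size = ≡.trans (sym (identityʳ (b c x))) (total-fibre c R (x ∷ []) (unique live) (covers live))
      lemma : ∀ b a → b * b * 1ℤ ≡ b * b * 1ℤ + a * 0ℤ
      lemma = solve-∀
    closedForm-[] c (x ∷ y ∷ L) live with constant? c
    ... | yes const = ⊥-elim (head-≢ (unique live) (here refl)
      (≡.trans (sym (fixed live (there (here refl)))) (≡.trans (const y x) (fixed live (here refl)))))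
    ... | no _ = lemma n (b c x) (b c y) (product (a c []) L) (quad (b c) (a c []) (y ∷ L))
      where
      lemma : ∀ n b b′ p q → n * n * 0ℤ ≡ b * b * ((0ℤ * n + b′ * 0ℤ) * p) + (0ℤ * n + b * 0ℤ) * q
      lemma = solve-∀

    module _ (I : List A) (rest : ClosedForm I) (v : A) where

      -- Induction on the neighbours `js` of `v` still to be decided. Contracting the edge to `j`
      -- merges the block of `j` into that of `v`, the distinguished block of `mergeQuad`, and the
      -- cost of a block is its number of undecided edges to `v`.
      row : ∀ js c L → Live c (c v ∷ L) →
        n * n * + treeCount (map (v ,_) js ++ cartesianProduct I R) c ≡
        mergeQuad (fibre c js) (b c) (a c I) L (b c (c v)) (a c I (c v))
      row [] c L live = ≡.trans (rest c (c v ∷ L) live) (sym (mergeQuad-zero (b c) (a c I) L _ _))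
      row (j ∷ js) c L live with c v ≟ c j
      -- A loop at the block of `v` affects the cost of that block alone, and this block is not in
      -- `L`.
      ... | yes loop = ≡.trans (cong (λ N → n * n * + N) (ℕ.+-identityʳ _))
        (≡.trans (row js c L live)
          (sym (mergeQuad-cong L (λ x∈ → fibre-there js λ cj≡x → head-≢ (unique live) x∈ (sym (≡.trans loop cj≡x)))
            (λ _ → refl) (λ _ → refl) _ _)))
      ... | no cv≢cj with covers live j
      ...   | here cj≡cv = ⊥-elim (cv≢cj (sym cj≡cv))
      ...   | there cj∈L with ∈-∃++ cj∈L
      ...     | L₁ , L₂ , refl = begin
        n * n * + (treeCount es c ℕ.+ treeCount es c′)
          ≡⟨ cong (n * n *_) (pos-+ (treeCount es c) (treeCount es c′)) ⟩
        n * n * (+ treeCount es c + + treeCount es c′)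
          ≡⟨ *-distribˡ-+ (n * n) (+ treeCount es c) (+ treeCount es c′) ⟩
        n * n * + treeCount es c + n * n * + treeCount es c′
          ≡⟨ cong₂ _+_ (row js c L live) (row js c′ (L₁ ++ L₂) live″) ⟩
        mergeQuad (fibre c js) (b c) (a c I) L β α +
        mergeQuad (fibre c′ js) (b c′) (a c′ I) (L₁ ++ L₂) (b c′ (c′ v)) (a c′ I (c′ v))
          ≡⟨ cong (λ z → mergeQuad (fibre c js) (b c) (a c I) L β α + z) merged ⟩
        mergeQuad (fibre c js) (b c) (a c I) L β α +
        mergeQuad (fibre c js) (b c) (a c I) (L₁ ++ L₂) (β + b c (c j)) (α + a c I (c j))
          ≡⟨ mergeQuad-suc (a c I) (fibre-here js refl) (b c) L₁ L₂
               (λ x∈ → fibre-there js (≢cj (∈-++⁺ˡ x∈) ∘ sym)) (λ x∈ → fibre-there js (≢cj (∈-++⁺ʳ L₁ x∈) ∘ sym)) β α ⟨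
        mergeQuad (fibre c (j ∷ js)) (b c) (a c I) L β α ∎
        where
        open ≡.≡-Reasoning
        es = map (v ,_) js ++ cartesianProduct I R
        c′ = contract c (v , j)
        β = b c (c v)
        α = a c I (c v)
        live′ : Live c (c v ∷ c j ∷ L₁ ++ L₂)
        live′ = Live-↭ (prep (c v) (shift (c j) L₁ L₂)) live
        c′v : c′ v ≡ c v
        c′v = relabel-self (c v) (c j)
        live″ : Live c′ (c′ v ∷ L₁ ++ L₂)
        live″ = subst (λ z → Live c′ (z ∷ L₁ ++ L₂)) (sym c′v) (Live-relabel live′)
        ≢cv : ∀ {x} → x ∈ L₁ ++ L₂ → x ≢ c v
        ≢cv x∈ = head-≢ (unique live′) (there x∈)
        ≢cj : ∀ {x} → x ∈ L₁ ++ L₂ → x ≢ c j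
        ≢cj x∈ with unique live′
        ... | _ ∷ uniq = head-≢ uniq x∈
        other : ∀ vs {x} → x ∈ L₁ ++ L₂ → fibre c′ vs x ≡ fibre c vs x
        other vs x∈ = fibre-other c (≢cv x∈) (≢cj x∈) vs
        b′v : b c′ (c′ v) ≡ β + b c (c j)
        b′v = ≡.trans (cong (b c′) c′v) (fibre-target c cv≢cj R)
        a′v : a c′ I (c′ v) ≡ α + a c I (c j)
        a′v = ≡.trans (cong₂ (λ l r → l * n + r * + length I) (≡.trans (cong (fibre c′ I) c′v) (fibre-target c cv≢cj I)) b′v)
          (lemma (fibre c I (c v)) (fibre c I (c j)) β (b c (c j)) n (+ length I))
          where lemma : ∀ l l′ r r′ n m → (l + l′) * n + (r + r′) * m ≡ l * n + r * m + (l′ * n + r′ * m)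
                lemma = solve-∀
        merged : mergeQuad (fibre c′ js) (b c′) (a c′ I) (L₁ ++ L₂) (b c′ (c′ v)) (a c′ I (c′ v)) ≡
                 mergeQuad (fibre c js) (b c) (a c I) (L₁ ++ L₂) (β + b c (c j)) (α + a c I (c j))
        merged = ≡.trans (cong₂ (mergeQuad (fibre c′ js) (b c′) (a c′ I) (L₁ ++ L₂)) b′v a′v)
          (mergeQuad-cong (L₁ ++ L₂) (other js) (other R)
            (λ x∈ → cong₂ (λ l r → l * n + r * + length I) (other I x∈) (other R x∈)) _ _)

    closedForm : ∀ I → ClosedForm I
    closedForm [] = closedForm-[]
    closedForm (v ∷ I) c L live with ∈-∃++ (covers live v)
    ... | L₁ , L₂ , refl = begin
      n * n * + treeCount (cartesianProduct (v ∷ I) R) c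
        ≡⟨ row I (closedForm I) v R c L′ live′ ⟩
      mergeQuad (b c) (b c) (a c I) L′ β α
        ≡⟨ mergeQuad-full (b c) (a c I) L′ β α ⟩
      β * β * product a⁺ L′ + (α + β + β + total (b c) L′) * quad (b c) a⁺ L′
        ≡⟨ cong₂ (λ p q → β * β * p + (α + β + β + total (b c) L′) * q) (product-cong L′ a⁺≡) (quad-cong L′ (λ _ → refl) a⁺≡) ⟩
      β * β * product (a c (v ∷ I)) L′ + (α + β + β + total (b c) L′) * quad (b c) (a c (v ∷ I)) L′
        ≡⟨ cong (λ k → β * β * product (a c (v ∷ I)) L′ + k * quad (b c) (a c (v ∷ I)) L′) own ⟩
      quad (b c) (a c (v ∷ I)) (c v ∷ L′)
        ≡⟨ quad-↭ (b c) (a c (v ∷ I)) (shift (c v) L₁ L₂) ⟨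
      quad (b c) (a c (v ∷ I)) (L₁ ++ c v ∷ L₂) ∎
      where
      open ≡.≡-Reasoning
      L′ = L₁ ++ L₂
      live′ : Live c (c v ∷ L′)
      live′ = Live-↭ (shift (c v) L₁ L₂) live
      β = b c (c v)
      α = a c I (c v)
      a⁺ : A → ℤ
      a⁺ x = a c I x + b c x
      a⁺≡ : ∀ {x} → x ∈ L′ → a⁺ x ≡ a c (v ∷ I) x
      a⁺≡ {x} x∈ rewrite fibre-there {c} {v} {x} I (head-≢ (unique live′) x∈ ∘ sym) =
        lemma (fibre c I x) (b c x) n (+ length I)
        where lemma : ∀ l r n m → l * n + r * m + r ≡ l * n + r * (1ℤ + m)
              lemma = solve-∀
      size : β + total (b c) L′ ≡ n
      size = total-fibre c R (c v ∷ L′) (unique live′) (covers live′)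
      -- One more left vertex in this block adds n to its weight, and the increase of `length I`
      -- adds `β`. The n is recovered as `β + total (b c) L′`, since the blocks partition the right
      -- vertices.
      own : α + β + β + total (b c) L′ ≡ a c (v ∷ I) (c v)
      own rewrite fibre-here {c} {v} I refl = begin
        α + β + β + total (b c) L′               ≡⟨ regroup α β (total (b c) L′) ⟩
        α + β + (β + total (b c) L′)             ≡⟨ cong (λ z → α + β + z) size ⟩
        α + β + n                                ≡⟨ lemma (fibre c I (c v)) β n (+ length I) ⟩
        (1ℤ + fibre c I (c v)) * n + β * + length (v ∷ I) ∎
        where regroup : ∀ r s t → r + s + s + t ≡ r + s + (s + t)
              regroup = solve-∀
              lemma : ∀ l r n m → l * n + r * m + r + n ≡ (1ℤ + l) * n + r * (1ℤ + m)
              lemma = solve-∀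

    -- Deleting the edges of a matching

    module _ (I : List A) where

      -- The ends of a matching edge, as singleton blocks, have weights `n` and `m`, and weight
      -- `n + m` once merged; `X` is the product of the first two minus the third.
      m X : ℤ
      m = + length I
      X = m * n - m - n

      record Isolated (c : A → A) (x y : A) : Set where
        field
          left-left : fibre c I x ≡ 1ℤ
          left-right : b c x ≡ 0ℤ
          right-left : fibre c I y ≡ 0ℤ
          right-right : b c y ≡ 1ℤ

      -- Deletion as difference: the trees avoiding an edge are all the trees minus those through it,
      -- and an edge that has been contracted is a loop, hence may be put back.
      avoiding-count : ∀ ms es c L → ms ++ es ↭ cartesianProduct I R → Live c (endpoints ms ++ L) →
        (∀ {x y} → (x , y) ∈ ms → Isolated c x y) →
        n * n * + treeCount es c ≡
        X ^ length ms * quad (b c) (a c I) L + power′ X (length ms) * (n - 1ℤ) * product (a c I) L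
      avoiding-count [] es c L perm live _ = begin
        n * n * + treeCount es c                       ≡⟨ cong (λ N → n * n * + N) (treeCount-↭ perm c) ⟩
        n * n * + treeCount (cartesianProduct I R) c   ≡⟨ closedForm I c L live ⟩
        quad (b c) (a c I) L                           ≡⟨ lemma (quad (b c) (a c I) L) (n - 1ℤ) (product (a c I) L) ⟩
        1ℤ * quad (b c) (a c I) L + 0ℤ * (n - 1ℤ) * product (a c I) L ∎
        where
        open ≡.≡-Reasoning
        lemma : ∀ q k p → q ≡ 1ℤ * q + 0ℤ * k * p
        lemma = solve-∀
      avoiding-count ((x , y) ∷ ms) es c L perm live isolated = begin
        n * n * + treeCount es c
          ≡⟨ difference ⟩
        n * n * + treeCount (e ∷ es) c - n * n * + treeCount (e ∷ es) c′
          ≡⟨ cong₂ _-_ (avoiding-count ms (e ∷ es) c (x ∷ y ∷ L) perm′ live₁ (isolated ∘ there))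
                       (avoiding-count ms (e ∷ es) c′ (x ∷ L) perm′ live₂ isolated′) ⟩
        S * quad (b c) (a c I) (x ∷ y ∷ L) + D * (n - 1ℤ) * product (a c I) (x ∷ y ∷ L) -
        (S * quad (b c′) (a c′ I) (x ∷ L) + D * (n - 1ℤ) * product (a c′ I) (x ∷ L))
          ≡⟨ evaluate ⟩
        X * S * quad (b c) (a c I) L + (X * D + S) * (n - 1ℤ) * product (a c I) L ∎
        where
        open ≡.≡-Reasoning
        e = (x , y)
        S = X ^ length ms
        D = power′ X (length ms)
        c′ = contract c e
        cx : c x ≡ x
        cx = fixed live (here refl)
        cy : c y ≡ y
        cy = fixed live (there (here refl))
        x≢y : x ≢ y
        x≢y = head-≢ (unique live) (here refl) ∘ sym
        c≢ : c x ≢ c y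
        c≢ eq = x≢y (≡.trans (sym cx) (≡.trans eq cy))
        difference : n * n * + treeCount es c ≡ n * n * + treeCount (e ∷ es) c - n * n * + treeCount (e ∷ es) c′
        difference
          rewrite treeCount-link {x} {y} es c c≢
                | treeCount-loop {x} {y} es c′ (relabel-joins (c x) (c y))
                | pos-+ (treeCount es c) (treeCount es c′) =
          lemma (n * n) (+ treeCount es c) (+ treeCount es c′)
          where lemma : ∀ k s t → k * s ≡ k * (s + t) - k * t
                lemma = solve-∀
        perm′ : ms ++ e ∷ es ↭ cartesianProduct I R
        perm′ = trans (shift e ms es) perm
        live₁ : Live c (endpoints ms ++ x ∷ y ∷ L)
        live₁ = Live-↭ (shifts (x ∷ y ∷ []) (endpoints ms)) live
        live₂ : Live c′ (endpoints ms ++ x ∷ L)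
        live₂ = Live-↭ (↭-sym (shift x (endpoints ms) L))
          (subst (λ p → Live (relabel p (c y) ∘ c) (x ∷ endpoints ms ++ L)) (sym cx)
            (subst (λ q → Live (relabel x q ∘ c) (x ∷ endpoints ms ++ L)) (sym cy) (Live-relabel live)))
        others : ∀ vs {z} → z ∈ endpoints ms ++ L → fibre c′ vs z ≡ fibre c vs z
        others vs z∈ with unique live
        ... | uniq@(_ ∷ uniq′) = fibre-other c
          (λ z≡ → head-≢ uniq (there z∈) (≡.trans z≡ cx)) (λ z≡ → head-≢ uniq′ z∈ (≡.trans z≡ cy)) vs
        isolated′ : ∀ {p q} → (p , q) ∈ ms → Isolated c′ p q
        isolated′ e∈ with endpoints-∈ e∈ | isolated (there e∈)
        ... | p∈ , q∈ | iso = record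
          { left-left = ≡.trans (others I (∈-++⁺ˡ p∈)) left-left
          ; left-right = ≡.trans (others R (∈-++⁺ˡ p∈)) left-right
          ; right-left = ≡.trans (others I (∈-++⁺ˡ q∈)) right-left
          ; right-right = ≡.trans (others R (∈-++⁺ˡ q∈)) right-right }
          where open Isolated iso
        joined : ∀ vs → fibre c′ vs x ≡ fibre c vs x + fibre c vs y
        joined vs = ≡.trans (cong (fibre c′ vs) (sym cx))
          (≡.trans (fibre-target c c≢ vs) (cong₂ (λ p q → fibre c vs p + fibre c vs q) cx cy))
        b′≡ : ∀ {z} → z ∈ L → b c′ z ≡ b c z
        b′≡ z∈ = others R (∈-++⁺ʳ (endpoints ms) z∈)
        a′≡ : ∀ {z} → z ∈ L → a c′ I z ≡ a c I z
        a′≡ z∈ = cong₂ (λ l r → l * n + r * m) (others I (∈-++⁺ʳ (endpoints ms) z∈)) (b′≡ z∈)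
        open Isolated (isolated (here refl))
        -- With P and Q the `product` and `quad` over `L`, separate ends contribute m n P and n P +
        -- m n Q, the merged block (n + m) P and P + (n + m) Q. The differences are X P and X Q + (n
        -- - 1) P: a triangular map with double eigenvalue X, whose powers produce the derivative.
        evaluate :
          S * quad (b c) (a c I) (x ∷ y ∷ L) + D * (n - 1ℤ) * product (a c I) (x ∷ y ∷ L) -
          (S * quad (b c′) (a c′ I) (x ∷ L) + D * (n - 1ℤ) * product (a c′ I) (x ∷ L)) ≡
          X * S * quad (b c) (a c I) L + (X * D + S) * (n - 1ℤ) * product (a c I) L
        evaluate
          rewrite quad-cong {a = a c′ I} {a c I} {b c′} {b c} L b′≡ a′≡ | product-cong {a = a c′ I} {a c I} L a′≡
                | joined I | joined R | left-left | left-right | right-left | right-right =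
          lemma n m S D (product (a c I) L) (quad (b c) (a c I) L)
          where
          lemma : ∀ n m S D P Q → let X = m * n - m - n in
            S * (0ℤ * 0ℤ * ((0ℤ * n + 1ℤ * m) * P) +
                 (1ℤ * n + 0ℤ * m) * (1ℤ * 1ℤ * P + (0ℤ * n + 1ℤ * m) * Q)) +
            D * (n - 1ℤ) * ((1ℤ * n + 0ℤ * m) * ((0ℤ * n + 1ℤ * m) * P)) -
            (S * ((0ℤ + 1ℤ) * (0ℤ + 1ℤ) * P + ((1ℤ + 0ℤ) * n + (0ℤ + 1ℤ) * m) * Q) +
             D * (n - 1ℤ) * (((1ℤ + 0ℤ) * n + (0ℤ + 1ℤ) * m) * P)) ≡
            X * S * Q + (X * D + S) * (n - 1ℤ) * P
          lemma = solve-∀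

-- The graph K_{m,n} − pK₂

pick : ∀ {A : Set} → (A → Bool) → (es : List A) → Vec Bool (length es)
pick t [] = []
pick t (e ∷ es) = t e ∷ pick t es

module _ {A : Set} where

  select-⊆ : ∀ {e : A} es bs → e ∈ select es bs → e ∈ es
  select-⊆ [] [] ()
  select-⊆ (_ ∷ es) (true ∷ bs) (here p) = here p
  select-⊆ (_ ∷ es) (true ∷ bs) (there p) = there (select-⊆ es bs p)
  select-⊆ (_ ∷ es) (false ∷ bs) p = there (select-⊆ es bs p)

  select-unique : ∀ {es : List A} bs → Unique es → Unique (select es bs)
  select-unique {[]} [] _ = []
  select-unique {e ∷ es} (true ∷ bs) (e∉ ∷ uniq) = All.tabulate (All.lookup e∉ ∘ select-⊆ es bs) ∷ select-unique bs uniq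
  select-unique {e ∷ es} (false ∷ bs) (_ ∷ uniq) = select-unique bs uniq

  select-pick⁺ : ∀ t {es} {e : A} → e ∈ es → t e ≡ true → e ∈ select es (pick t es)
  select-pick⁺ t (here {x = d} refl) te with t d
  select-pick⁺ t (here refl) refl | true = here refl
  select-pick⁺ t (there {x = d} e∈) te with t d
  ... | true = there (select-pick⁺ t e∈ te)
  ... | false = select-pick⁺ t e∈ te

  select-pick⁻ : ∀ t es {e : A} → e ∈ select es (pick t es) → t e ≡ true
  select-pick⁻ t (d ∷ es) e∈ with t d in eq
  select-pick⁻ t (d ∷ es) (here refl) | true = eq
  select-pick⁻ t (d ∷ es) (there e∈) | true = select-pick⁻ t es e∈
  ... | false = select-pick⁻ t es e∈

  -- In a list without repetitions a position is determined by its element, so the bits can be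
  -- recovered from membership alone.
  pick-select : ∀ t {es : List A} bs → Unique es →
    (∀ {e} → e ∈ es → t e ≡ true → e ∈ select es bs) → (∀ {e} → e ∈ select es bs → t e ≡ true) → pick t es ≡ bs
  pick-select t {[]} [] _ _ _ = refl
  pick-select t {e ∷ es} (true ∷ bs) (e∉ ∷ uniq) sound complete =
    cong₂ _∷_ (complete (here refl)) (pick-select t bs uniq tail (complete ∘ there))
    where
    tail : ∀ {d} → d ∈ es → t d ≡ true → d ∈ select es bs
    tail d∈ td with sound (there d∈) td
    ... | here refl = ⊥-elim (All.lookup e∉ d∈ refl)
    ... | there d∈′ = d∈′
  pick-select t {e ∷ es} (false ∷ bs) (e∉ ∷ uniq) sound complete =
    cong₂ _∷_ head (pick-select t bs uniq (sound ∘ there) complete)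
    where
    head : t e ≡ false
    head with t e in eq
    ... | false = refl
    ... | true = ⊥-elim (All.lookup e∉ (select-⊆ es bs (sound (here refl) eq)) refl)

endpoints-↭ : ∀ {A : Set} (ms : List (A × A)) → endpoints ms ↭ map proj₁ ms ++ map proj₂ ms
endpoints-↭ [] = refl
endpoints-↭ ((x , y) ∷ ms) = prep x (trans (prep y (endpoints-↭ ms)) (↭-sym (shift y (map proj₁ ms) (map proj₂ ms))))

Walk⇒Star : ∀ {m n} {T : EdgeSet m n} {u v} → Walk T u v → Star (Adj T) u v
Walk⇒Star nil = ε
Walk⇒Star (cons r w) = r ◅ Walk⇒Star w

Star⇒Walk : ∀ {m n} {T : EdgeSet m n} {u v} → Star (Adj T) u v → Walk T u v
Star⇒Walk ε = nil
Star⇒Walk (r ◅ w) = cons r (Star⇒Walk w)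

module NearlyComplete (p k l : ℕ) where

  -- `k` and `l` count the unmatched vertices on the two sides, so the exponents m - p and n - p
  -- need no subtraction.
  m n : ℕ
  m = p ℕ.+ k
  n = p ℕ.+ l

  infix 4 _≟_
  _≟_ : DecidableEquality (V m n)
  _≟_ = Sum.≡-dec Fin._≟_ Fin._≟_

  open DecMembership (Product.≡-dec _≟_ _≟_) using (_∈?_)

  lefts rights : List (V m n)
  lefts = map inj₁ (allFin m)
  rights = map inj₂ (allFin n)

  ∈-lefts : ∀ i → inj₁ i ∈ lefts
  ∈-lefts i = ∈-map⁺ inj₁ (∈-allFin i)

  ∈-rights : ∀ j → inj₂ j ∈ rights
  ∈-rights j = ∈-map⁺ inj₂ (∈-allFin j)

  ∈-vertices : ∀ v → v ∈ lefts ++ rights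
  ∈-vertices (inj₁ i) = ∈-++⁺ˡ (∈-lefts i)
  ∈-vertices (inj₂ j) = ∈-++⁺ʳ lefts (∈-rights j)

  constant? : (c : V m n → V m n) → Dec (∀ x y → c x ≡ c y)
  constant? c = map′
    (λ h x y → All.lookup (All.lookup h (∈-vertices x)) (∈-vertices y))
    (λ h → All.tabulate λ {x} _ → All.tabulate λ {y} _ → h x y)
    (All.all? (λ x → All.all? (λ y → c x ≟ c y) (lefts ++ rights)) (lefts ++ rights))

  open Contraction _≟_
  open Counting constant?
  open ClosedForm _≟_ constant?

  matched : Fin p → V m n × V m n
  matched i = inj₁ (i ↑ˡ k) , inj₂ (i ↑ˡ l)

  matching edges all-edges : List (V m n × V m n)
  matching = map matched (allFin p)
  all-edges = cartesianProduct lefts rights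
  edges = filter (λ e → ¬? (e ∈? matching)) all-edges

  Unique-lefts : Unique lefts
  Unique-lefts = Unique.map⁺ Sum.inj₁-injective (Unique.allFin⁺ m)

  Unique-rights : Unique rights
  Unique-rights = Unique.map⁺ Sum.inj₂-injective (Unique.allFin⁺ n)

  Unique-all-edges : Unique all-edges
  Unique-all-edges = Unique.cartesianProduct⁺ Unique-lefts Unique-rights

  Unique-edges : Unique edges
  Unique-edges = Unique.filter⁺ _ Unique-all-edges

  Unique-matching : Unique matching
  Unique-matching = Unique.map⁺ (λ eq → Fin.↑ˡ-injective k _ _ (Sum.inj₁-injective (cong proj₁ eq))) (Unique.allFin⁺ p)

  -- Two repetition-free lists with the same members are permutations of each other.
  split-edges : matching ++ edges ↭ all-edges
  split-edges = ∼bag⇒↭ (unique∧set⇒bag (Unique.++⁺ Unique-matching Unique-edges disjoint) Unique-all-edges (mk⇔ to from))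
    where
    disjoint : ∀ {e} → e ∈ matching × e ∈ edges → ⊥
    disjoint (e∈ , e∈′) = proj₂ (∈-filter⁻ _ {xs = all-edges} e∈′) e∈
    to : ∀ {e} → e ∈ matching ++ edges → e ∈ all-edges
    to e∈ with ∈-++⁻ matching e∈
    ... | inj₂ e∈′ = proj₁ (∈-filter⁻ _ {xs = all-edges} e∈′)
    ... | inj₁ e∈′ with ∈-map⁻ matched e∈′
    ...   | i , _ , refl = ∈-cartesianProduct⁺ (∈-lefts (i ↑ˡ k)) (∈-rights (i ↑ˡ l))
    from : ∀ {e} → e ∈ all-edges → e ∈ matching ++ edges
    from {e} e∈ with e ∈? matching
    ... | yes e∈′ = ∈-++⁺ˡ e∈′
    ... | no e∉ = ∈-++⁺ʳ matching (∈-filter⁺ _ e∈ e∉)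

  edges-oriented : ∀ {x y} → (x , y) ∈ edges → (∃ λ i → x ≡ inj₁ i) × (∃ λ j → y ≡ inj₂ j)
  edges-oriented e∈ with ∈-cartesianProduct⁻ lefts rights (proj₁ (∈-filter⁻ _ {xs = all-edges} e∈))
  ... | x∈ , y∈ with ∈-map⁻ inj₁ x∈ | ∈-map⁻ inj₂ y∈
  ...   | i , _ , eq | j , _ , eq′ = (i , eq) , (j , eq′)

  edges-sound : ∀ {i j} → (inj₁ i , inj₂ j) ∈ edges → InKmnMinus p i j
  edges-sound {i} {j} e∈ (i≡j , i<p) = proj₂ (∈-filter⁻ _ {xs = all-edges} e∈)
    (subst (_∈ matching) (cong₂ (λ i j → inj₁ i , inj₂ j) (lift i i<p refl) (lift j i<p (sym i≡j)))
      (∈-map⁺ matched (∈-allFin (fromℕ< i<p))))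
    where
    lift : ∀ {r s} (h : Fin (p ℕ.+ r)) (s<p : s ℕ.< p) → toℕ h ≡ s → fromℕ< s<p ↑ˡ r ≡ h
    lift {r} h s<p eq = Fin.toℕ-injective (≡.trans (Fin.toℕ-↑ˡ (fromℕ< s<p) r) (≡.trans (Fin.toℕ-fromℕ< s<p) (sym eq)))

  edges-complete : ∀ {i j} → InKmnMinus p i j → (inj₁ i , inj₂ j) ∈ edges
  edges-complete {i} {j} ok = ∈-filter⁺ _ (∈-cartesianProduct⁺ (∈-lefts i) (∈-rights j)) notMatched
    where
    notMatched : (inj₁ i , inj₂ j) ∉ matching
    notMatched e∈ with ∈-map⁻ matched e∈
    ... | h , _ , refl = ok (≡.trans (Fin.toℕ-↑ˡ h k) (sym (Fin.toℕ-↑ˡ h l)) ,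
                              subst (ℕ._< p) (sym (Fin.toℕ-↑ˡ h k)) (Fin.toℕ<n h))

  module Represents (T : EdgeSet m n) (ds : List (V m n × V m n))
    (sound : ∀ {i j} → (inj₁ i , inj₂ j) ∈ ds → lookup (lookup T i) j ≡ true)
    (complete : ∀ {i j} → lookup (lookup T i) j ≡ true → (inj₁ i , inj₂ j) ∈ ds)
    (oriented : ∀ {x y} → (x , y) ∈ ds → (∃ λ i → x ≡ inj₁ i) × (∃ λ j → y ≡ inj₂ j))
    (unique : Unique ds) where

    -- The list is reversed because the greedy test stacks up contracted edges, ending with
    -- `ds ʳ++ []`.
    Joined⇒Adj : ∀ {x y} → Joined (reverse ds) x y → Adj T x y
    Joined⇒Adj (inj₁ e∈) with ∈-resp-↭ (↭-reverse ds) e∈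
    ... | e∈′ with oriented e∈′
    ...   | (i , refl) , (j , refl) = sound e∈′
    Joined⇒Adj (inj₂ e∈) with ∈-resp-↭ (↭-reverse ds) e∈
    ... | e∈′ with oriented e∈′
    ...   | (i , refl) , (j , refl) = sound e∈′

    Adj⇒Joined : ∀ {x y} → Adj T x y → Joined (reverse ds) x y
    Adj⇒Joined {inj₁ i} {inj₂ j} eq = inj₁ (∈-resp-↭ (↭-sym (↭-reverse ds)) (complete eq))
    Adj⇒Joined {inj₂ j} {inj₁ i} eq = inj₂ (∈-resp-↭ (↭-sym (↭-reverse ds)) (complete eq))

    IsTree⇒spanning : IsTree ds id → Connected T × Acyclic T
    IsTree⇒spanning tree with IsTree-sound ds Components-id Acyclic-[] tree
    ... | acyclic , connected =
      (λ u v → Star⇒Walk (Star.map Joined⇒Adj (connected u v))) ,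
      (λ v ws → acyclic v ws ∘ Cycle-map Adj⇒Joined)

    spanning⇒IsTree : Connected T → Acyclic T → IsTree ds id
    spanning⇒IsTree connected acyclic = IsTree-complete (λ x → ∃ λ i → x ≡ inj₁ i) ds Components-id left
      (Unique-resp-↭ (↭-sym (↭-reverse ds)) unique)
      (λ v ws → acyclic v ws ∘ Cycle-map Joined⇒Adj) (λ u v → Star.map Adj⇒Joined (Walk⇒Star (connected u v)))
      where
      left : ∀ {x y} → (x , y) ∈ reverse ds → (∃ λ i → x ≡ inj₁ i) × ¬ (∃ λ i → y ≡ inj₁ i)
      left e∈ with oriented (∈-resp-↭ (↭-reverse ds) e∈)
      ... | x-left , (_ , refl) = x-left , λ ()

  -- Edge subsets as Boolean matrices

  toMatrix : Vec Bool (length edges) → EdgeSet m n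
  toMatrix bs = tabulate λ i → tabulate λ j → does ((inj₁ i , inj₂ j) ∈? select edges bs)

  entry : EdgeSet m n → V m n × V m n → Bool
  entry T (inj₁ i , inj₂ j) = lookup (lookup T i) j
  entry T _ = false

  fromMatrix : EdgeSet m n → Vec Bool (length edges)
  fromMatrix T = pick (entry T) edges

  lookup-toMatrix : ∀ bs i j → lookup (lookup (toMatrix bs) i) j ≡ does ((inj₁ i , inj₂ j) ∈? select edges bs)
  lookup-toMatrix bs i j = ≡.trans (cong (λ r → lookup r j) (lookup∘tabulate _ i)) (lookup∘tabulate _ j)

  toMatrix-sound : ∀ bs {i j} → (inj₁ i , inj₂ j) ∈ select edges bs → lookup (lookup (toMatrix bs) i) j ≡ true
  toMatrix-sound bs {i} {j} e∈ rewrite lookup-toMatrix bs i j with (inj₁ i , inj₂ j) ∈? select edges bs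
  ... | yes _ = refl
  ... | no e∉ = ⊥-elim (e∉ e∈)

  toMatrix-complete : ∀ bs {i j} → lookup (lookup (toMatrix bs) i) j ≡ true → (inj₁ i , inj₂ j) ∈ select edges bs
  toMatrix-complete bs {i} {j} eq rewrite lookup-toMatrix bs i j with (inj₁ i , inj₂ j) ∈? select edges bs
  ... | yes e∈ = e∈

  fromMatrix-toMatrix : ∀ bs → fromMatrix (toMatrix bs) ≡ bs
  fromMatrix-toMatrix bs = pick-select (entry (toMatrix bs)) bs Unique-edges sound complete
    where
    sound : ∀ {e} → e ∈ edges → entry (toMatrix bs) e ≡ true → e ∈ select edges bs
    sound e∈ eq with edges-oriented e∈
    ... | (_ , refl) , (_ , refl) = toMatrix-complete bs eq
    complete : ∀ {e} → e ∈ select edges bs → entry (toMatrix bs) e ≡ true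
    complete e∈ with edges-oriented (select-⊆ edges bs e∈)
    ... | (_ , refl) , (_ , refl) = toMatrix-sound bs e∈

  toMatrix-fromMatrix : ∀ T → SubgraphOf p T → toMatrix (fromMatrix T) ≡ T
  toMatrix-fromMatrix T sub = ≡.trans
    (tabulate-cong λ i → ≡.trans (tabulate-cong (same i)) (tabulate∘lookup (lookup T i)))
    (tabulate∘lookup T)
    where
    same : ∀ i j → does ((inj₁ i , inj₂ j) ∈? select edges (fromMatrix T)) ≡ lookup (lookup T i) j
    same i j with (inj₁ i , inj₂ j) ∈? select edges (fromMatrix T)
    ... | yes e∈ = sym (select-pick⁻ (entry T) edges e∈)
    ... | no e∉ with lookup (lookup T i) j in eq
    ...   | false = refl
    ...   | true = ⊥-elim (e∉ (select-pick⁺ (entry T) (edges-complete (sub i j eq)) eq))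

  spanningTreeCount : ℕ
  spanningTreeCount = treeCount edges id

  spanningTree-card : HasCard (IsSpanningTree m n p) spanningTreeCount
  spanningTree-card = HasCard-map toMatrix fromMatrix fromMatrix-toMatrix to from (treeCount-card edges id)
    where
    to : ∀ bs → IsTree (select edges bs) id → IsSpanningTree m n p (toMatrix bs)
    to bs tree = (λ i j eq → edges-sound (select-⊆ edges bs (toMatrix-complete bs eq))) ,
      Represents.IsTree⇒spanning (toMatrix bs) (select edges bs) (toMatrix-sound bs) (toMatrix-complete bs)
        (edges-oriented ∘ select-⊆ edges bs) (select-unique bs Unique-edges) tree
    from : ∀ T → IsSpanningTree m n p T → IsTree (select edges (fromMatrix T)) id × toMatrix (fromMatrix T) ≡ T
    from T (sub , connected , acyclic) =
      Represents.spanning⇒IsTree T (select edges bs) (select-pick⁻ (entry T) edges)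
        (λ {i} {j} eq → select-pick⁺ (entry T) (edges-complete (sub i j eq)) eq)
        (edges-oriented ∘ select-⊆ edges bs) (select-unique bs Unique-edges) connected acyclic ,
      toMatrix-fromMatrix T sub
      where bs = fromMatrix T

  -- Evaluation at the partition into singletons

  freeLefts freeRights : List (V m n)
  freeLefts = map (λ i → inj₁ (p ↑ʳ i)) (allFin k)
  freeRights = map (λ j → inj₂ (p ↑ʳ j)) (allFin l)

  ↑ˡ≢↑ʳ : ∀ {r} (i : Fin p) (j : Fin r) → i ↑ˡ r ≢ p ↑ʳ j
  ↑ˡ≢↑ʳ {r} i j eq = ℕ.<⇒≢ (ℕ.<-≤-trans (Fin.toℕ<n i) (ℕ.m≤m+n p (toℕ j)))
    (≡.trans (sym (Fin.toℕ-↑ˡ i r)) (≡.trans (cong toℕ eq) (Fin.toℕ-↑ʳ p j)))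

  -- The matched vertices stand in front, pair by pair, as `avoiding-count` consumes them; the
  -- unmatched ones remain as its `L`.
  live-id : Live id (endpoints matching ++ freeLefts ++ freeRights)
  live-id = record { unique = unique ; covers = covers ; fixed = λ _ → refl }
    where
    matchedLefts = map (λ i → inj₁ (i ↑ˡ k)) (allFin p)
    matchedRights = map (λ i → inj₂ (i ↑ˡ l)) (allFin p)
    disjoint-sides : ∀ {r s} {f : Fin r → Fin m} {g : Fin s → Fin n} {x} →
      x ∈ map (inj₁ ∘ f) (allFin r) × x ∈ map (inj₂ ∘ g) (allFin s) → ⊥
    disjoint-sides (x∈ , x∈′) with ∈-map⁻ _ x∈ | ∈-map⁻ _ x∈′
    ... | _ , _ , refl | _ , _ , ()
    endpoints-matching : endpoints matching ↭ matchedLefts ++ matchedRights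
    endpoints-matching = subst (endpoints matching ↭_)
      (cong₂ _++_ (sym (map-∘ (allFin p))) (sym (map-∘ (allFin p)))) (endpoints-↭ matching)
    disjoint : ∀ {x} → x ∈ endpoints matching × x ∈ freeLefts ++ freeRights → ⊥
    disjoint (x∈ , x∈′) with ∈-++⁻ matchedLefts (∈-resp-↭ endpoints-matching x∈) | ∈-++⁻ freeLefts x∈′
    ... | inj₁ q | inj₂ q′ = disjoint-sides (q , q′)
    ... | inj₂ q | inj₁ q′ = disjoint-sides (q′ , q)
    ... | inj₁ q | inj₁ q′ with ∈-map⁻ _ q | ∈-map⁻ _ q′
    ...   | i , _ , refl | j , _ , eq = ↑ˡ≢↑ʳ i j (Sum.inj₁-injective eq)
    disjoint (x∈ , x∈′) | inj₂ q | inj₂ q′ with ∈-map⁻ _ q | ∈-map⁻ _ q′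
    ...   | i , _ , refl | j , _ , eq = ↑ˡ≢↑ʳ i j (Sum.inj₂-injective eq)
    unique : Unique (endpoints matching ++ freeLefts ++ freeRights)
    unique = Unique.++⁺
      (Unique-resp-↭ (↭-sym endpoints-matching) (Unique.++⁺
        (Unique.map⁺ (Fin.↑ˡ-injective k _ _ ∘ Sum.inj₁-injective) (Unique.allFin⁺ p))
        (Unique.map⁺ (Fin.↑ˡ-injective l _ _ ∘ Sum.inj₂-injective) (Unique.allFin⁺ p)) disjoint-sides))
      (Unique.++⁺
        (Unique.map⁺ (Fin.↑ʳ-injective p _ _ ∘ Sum.inj₁-injective) (Unique.allFin⁺ k))
        (Unique.map⁺ (Fin.↑ʳ-injective p _ _ ∘ Sum.inj₂-injective) (Unique.allFin⁺ l)) disjoint-sides)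
      disjoint
    covers : ∀ v → v ∈ endpoints matching ++ freeLefts ++ freeRights
    covers (inj₁ i) with splitAt p i in eq
    ... | inj₁ h rewrite sym (Fin.splitAt⁻¹-↑ˡ eq) = ∈-++⁺ˡ (proj₁ (endpoints-∈ (∈-map⁺ matched (∈-allFin h))))
    ... | inj₂ h rewrite sym (Fin.splitAt⁻¹-↑ʳ {p} eq) = ∈-++⁺ʳ (endpoints matching) (∈-++⁺ˡ (∈-map⁺ _ (∈-allFin h)))
    covers (inj₂ j) with splitAt p j in eq
    ... | inj₁ h rewrite sym (Fin.splitAt⁻¹-↑ˡ eq) = ∈-++⁺ˡ (proj₂ (endpoints-∈ (∈-map⁺ matched (∈-allFin h))))
    ... | inj₂ h rewrite sym (Fin.splitAt⁻¹-↑ʳ {p} eq) = ∈-++⁺ʳ (endpoints matching) (∈-++⁺ʳ freeLefts (∈-map⁺ _ (∈-allFin h)))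

  left-left : ∀ i → fibre id lefts (inj₁ i) ≡ 1ℤ
  left-left i = fibre-id Unique-lefts (∈-lefts i)

  right-right : ∀ j → fibre id rights (inj₂ j) ≡ 1ℤ
  right-right j = fibre-id Unique-rights (∈-rights j)

  left-right : ∀ i → fibre id rights (inj₁ i) ≡ 0ℤ
  left-right i = fibre-absent {id} rights notLeft
    where
    notLeft : ∀ {v} → v ∈ rights → v ≢ inj₁ i
    notLeft v∈ refl with ∈-map⁻ inj₂ v∈
    ... | _ , _ , ()

  right-left : ∀ j → fibre id lefts (inj₂ j) ≡ 0ℤ
  right-left j = fibre-absent {id} lefts notRight
    where
    notRight : ∀ {v} → v ∈ lefts → v ≢ inj₂ j
    notRight v∈ refl with ∈-map⁻ inj₁ v∈
    ... | _ , _ , ()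

  length-map-allFin : ∀ {B : Set} {r} (f : Fin r → B) → length (map f (allFin r)) ≡ r
  length-map-allFin {r = r} f = ≡.trans (length-map f (allFin r)) (length-tabulate id)

  isolated : ∀ {x y} → (x , y) ∈ matching → Bipartite.Isolated rights lefts id x y
  isolated e∈ with ∈-map⁻ matched e∈
  ... | i , _ , refl = record
    { left-left = left-left (i ↑ˡ k) ; left-right = left-right (i ↑ˡ k)
    ; right-left = right-left (i ↑ˡ l) ; right-right = right-right (i ↑ˡ l) }

  -- The parameters allow the identity to be proved for the lengths of the lists and then rewritten
  -- to m, n and p. The extra factor `M` is needed because the unmatched right vertices contribute l
  -- M^(l-1), which has no natural exponent at l = 0; the unmatched left ones contribute nothing to
  -- `quad`, since r = 0 there.
  Identity : ℕ → ℕ → ℕ → Set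
  Identity r s t = let M = + r; N = + s; X = M * N - M - N in
    M * (N * N * + spanningTreeCount) ≡ N ^ k * M ^ l * (X ^ t * + l + power′ X t * (N - 1ℤ) * M)

  identity : Identity m n p
  identity =
    subst (λ r → Identity r n p) (length-map-allFin inj₁)
      (subst (λ s → Identity (length lefts) s p) (length-map-allFin inj₂)
        (subst (Identity (length lefts) (length rights)) (length-map-allFin matched) raw))
    where
    open ≡.≡-Reasoning
    open Bipartite rights using (a; b; avoiding-count)
    M = + length lefts
    N = + length rights
    X = M * N - M - N
    S = X ^ length matching
    D = power′ X (length matching)
    a₀ b₀ : V m n → ℤ
    a₀ = a id lefts
    b₀ = b id
    a-left : ∀ {x} → x ∈ freeLefts → a₀ x ≡ N
    a-left x∈ with ∈-map⁻ _ x∈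
    ... | i , _ , refl rewrite left-left (p ↑ʳ i) | left-right (p ↑ʳ i) = lemma N M
      where lemma : ∀ N M → 1ℤ * N + 0ℤ * M ≡ N
            lemma = solve-∀
    a-right : ∀ {x} → x ∈ freeRights → a₀ x ≡ M
    a-right x∈ with ∈-map⁻ _ x∈
    ... | j , _ , refl rewrite right-left (p ↑ʳ j) | right-right (p ↑ʳ j) = lemma N M
      where lemma : ∀ N M → 0ℤ * N + 1ℤ * M ≡ M
            lemma = solve-∀
    b-left : ∀ {x} → x ∈ freeLefts → b₀ x ≡ 0ℤ
    b-left x∈ with ∈-map⁻ _ x∈
    ... | i , _ , refl = left-right (p ↑ʳ i)
    b-right : ∀ {x} → x ∈ freeRights → b₀ x ≡ 1ℤ
    b-right x∈ with ∈-map⁻ _ x∈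
    ... | j , _ , refl = right-right (p ↑ʳ j)
    length-freeLefts : length freeLefts ≡ k
    length-freeLefts = length-map-allFin (λ i → inj₁ (p ↑ʳ i))
    length-freeRights : length freeRights ≡ l
    length-freeRights = length-map-allFin (λ j → inj₂ (p ↑ʳ j))
    product-lefts : product a₀ freeLefts ≡ N ^ k
    product-lefts = ≡.trans (product-const a₀ freeLefts a-left) (cong (N ^_) length-freeLefts)
    product-rights : product a₀ freeRights ≡ M ^ l
    product-rights = ≡.trans (product-const a₀ freeRights a-right) (cong (M ^_) length-freeRights)
    quad-rights : M * quad b₀ a₀ freeRights ≡ + l * M ^ l
    quad-rights = ≡.trans (quad-const b₀ a₀ freeRights b-right a-right)
      (cong (λ r → + r * M ^ r) length-freeRights)
    raw : Identity (length lefts) (length rights) (length matching)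
    raw = begin
      M * (N * N * + spanningTreeCount)
        ≡⟨ cong (M *_) (avoiding-count lefts matching edges id (freeLefts ++ freeRights) split-edges live-id isolated) ⟩
      M * (S * quad b₀ a₀ (freeLefts ++ freeRights) + D * (N - 1ℤ) * product a₀ (freeLefts ++ freeRights))
        ≡⟨ cong₂ (λ q r → M * (S * q + D * (N - 1ℤ) * r)) (quad-++ b₀ a₀ freeLefts freeRights)
             (product-++ a₀ freeLefts freeRights) ⟩
      M * (S * (quad b₀ a₀ freeLefts * Pʳ + Pˡ * Q) + D * (N - 1ℤ) * (Pˡ * Pʳ))
        ≡⟨ cong (λ q → M * (S * (q * Pʳ + Pˡ * Q) + D * (N - 1ℤ) * (Pˡ * Pʳ))) (quad-zero b₀ a₀ freeLefts b-left) ⟩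
      M * (S * (0ℤ * Pʳ + Pˡ * Q) + D * (N - 1ℤ) * (Pˡ * Pʳ))
        ≡⟨ cong₂ (λ r s → M * (S * (0ℤ * s + r * Q) + D * (N - 1ℤ) * (r * s))) product-lefts product-rights ⟩
      M * (S * (0ℤ * M ^ l + N ^ k * Q) + D * (N - 1ℤ) * (N ^ k * M ^ l))
        ≡⟨ expose M S (M ^ l) (N ^ k) Q D N ⟩
      S * N ^ k * (M * Q) + M * (D * (N - 1ℤ) * (N ^ k * M ^ l))
        ≡⟨ cong (λ q → S * N ^ k * q + M * (D * (N - 1ℤ) * (N ^ k * M ^ l))) quad-rights ⟩
      S * N ^ k * (+ l * M ^ l) + M * (D * (N - 1ℤ) * (N ^ k * M ^ l))
        ≡⟨ collect M S (M ^ l) (N ^ k) (+ l) D N ⟩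
      N ^ k * M ^ l * (S * + l + D * (N - 1ℤ) * M) ∎
      where
      Q = quad b₀ a₀ freeRights
      Pˡ = product a₀ freeLefts
      Pʳ = product a₀ freeRights
      expose : ∀ M S s r Q D N → M * (S * (0ℤ * s + r * Q) + D * (N - 1ℤ) * (r * s)) ≡
                              S * r * (M * Q) + M * (D * (N - 1ℤ) * (r * s))
      expose = solve-∀
      collect : ∀ M S s r l D N → S * r * (l * s) + M * (D * (N - 1ℤ) * (r * s)) ≡ r * s * (S * l + D * (N - 1ℤ) * M)
      collect = solve-∀

-- One factor n can be split off the right-hand side and cancelled, which leaves m n N on the left.
-- The case p = 0 is separate because `power′` is then zero and the formula has its own reading
-- there.
identity⇒formula : ∀ p k l N → 1 ≤ p ℕ.+ l →
  (let m = + (p ℕ.+ k); n = + (p ℕ.+ l); X = m * n - m - n in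
   m * (n * n * + N) ≡ n ^ k * m ^ l * (X ^ p * + l + power′ X p * (n - 1ℤ) * m)) →
  + N * + ((p ℕ.+ k) ℕ.* (p ℕ.+ l)) ≡ formulaTimesMN (p ℕ.+ k) (p ℕ.+ l) p
identity⇒formula zero k l@(suc _) N _ eq = *-cancelˡ-≡ (+ l) _ _ (begin
  + l * (+ N * + (k ℕ.* l))      ≡⟨ cong (λ z → + l * (+ N * z)) (pos-* k l) ⟩
  + l * (+ N * (+ k * + l))      ≡⟨ rearrange (+ k) (+ l) (+ N) ⟩
  + k * (+ l * + l * + N)        ≡⟨ eq ⟩
  (+ l) ^ k * (+ k) ^ l * (1ℤ * + l + 0ℤ * (+ l - 1ℤ) * + k)  ≡⟨ collect (+ k) (+ l) ((+ l) ^ k) ((+ k) ^ l) ⟩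
  + l * ((+ k) ^ l * (+ l) ^ k)      ∎)
  where
  open ≡.≡-Reasoning
  rearrange : ∀ k l N → l * (N * (k * l)) ≡ k * (l * l * N)
  rearrange = solve-∀
  collect : ∀ k l r s → r * s * (1ℤ * l + 0ℤ * (l - 1ℤ) * k) ≡ l * (s * r)
  collect = solve-∀
identity⇒formula p@(suc q) k l N _ eq
  rewrite ℕ.m+n∸m≡n q k | ℕ.m+n∸m≡n q l = *-cancelˡ-≡ n _ _ (begin
  n * (+ N * + ((p ℕ.+ k) ℕ.* (p ℕ.+ l)))   ≡⟨ cong (λ z → n * (+ N * z)) mn≡ ⟩
  n * (+ N * (m * n))    ≡⟨ rearrange m n (+ N) ⟩
  m * (n * n * + N)      ≡⟨ eq ⟩
  n ^ k * m ^ l * (X ^ p * + l + power′ X p * (n - 1ℤ) * m)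
    ≡⟨ cong (λ d → n ^ k * m ^ l * (X ^ p * + l + d * (n - 1ℤ) * m)) (power′-suc X q) ⟩
  n ^ k * m ^ l * (X * X ^ q * + l + + p * X ^ q * (n - 1ℤ) * m)
    ≡⟨ collect m (+ p) (+ l) (n ^ k) (m ^ l) (X ^ q) ⟩
  n * ((X + + p) * X ^ q * m ^ l * n ^ k)
    ≡⟨ cong (λ z → n * ((z - m - n + + p) * (z - m - n) ^ q * m ^ l * n ^ k)) mn≡ ⟨
  n * ((+ ((p ℕ.+ k) ℕ.* (p ℕ.+ l)) - m - n + + p) * (+ ((p ℕ.+ k) ℕ.* (p ℕ.+ l)) - m - n) ^ q * m ^ l * n ^ k) ∎)
  where
  open ≡.≡-Reasoning
  m = + (p ℕ.+ k)
  n = + (p ℕ.+ l)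
  X = m * n - m - n
  mn≡ : + ((p ℕ.+ k) ℕ.* (p ℕ.+ l)) ≡ m * n
  mn≡ = pos-* (p ℕ.+ k) (p ℕ.+ l)
  rearrange : ∀ m n N → n * (N * (m * n)) ≡ m * (n * n * N)
  rearrange = solve-∀
  -- Since (n - 1) m = X + n, the bracket l X + p (n - 1) m equals (l + p) X + p n = n (X + p).
  collect : ∀ m p l r s t → let n = p + l; X = m * n - m - n in
    r * s * (X * t * l + p * t * (n - 1ℤ) * m) ≡ n * ((X + p) * t * s * r)
  collect = solve-∀

theorem1p5 : (m n p : ℕ) → 1 ≤ m → 1 ≤ n → p ≤ m → p ≤ n →
    ∃ λ N → HasCard (IsSpanningTree m n p) N × (+ N) Data.Integer.* (+ (m ℕ.* n)) ≡ formulaTimesMN m n p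
theorem1p5 m n p 1≤m 1≤n p≤m p≤n with ℕ.m≤n⇒∃[o]m+o≡n p≤m | ℕ.m≤n⇒∃[o]m+o≡n p≤n
... | k , refl | l , refl =
  spanningTreeCount , spanningTree-card , identity⇒formula p k l spanningTreeCount 1≤n identity
  where open NearlyComplete p k l
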